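{- Let $a,b$ be coprime positive integers, let $n\ge 0$ be an integer and let $x$ be a variable. Then $$\sum_{i=1}^{b-1}\sum_{j=1}^{a-1}\left(\frac{x}{ab}+\frac{j}{a}+\frac{i}{b}\right)^n=\frac{x^n}{(ab)^n}-\frac{B_{n+1}\left(\frac{x}{a}+b\right)-B_{n+1}\left(\frac{x}{a}\right)}{b^n(n+1)}-\frac{B_{n+1}\left(\frac{x}{b}+a\right)-B_{n+1}\left(\frac{x}{b}\right)}{a^n(n+1)}$$ $$+\frac{B_{n+1}(x+ab)-B_{n+1}(x)}{(ab)^n(n+1)}+\frac{1}{(ab)^n}\sum_{i=0}^n\binom{n}{i}\left((x+ab)^{n-i}-x^{n-i}\right)S_{a,b}(i).$$ In particular, for $x=0$, $$\sum_{i=1}^{b-1}\sum_{j=1}^{a-1}\left(\frac{j}{a}+\frac{i}{b}\right)^n=\sum_{i=0}^{n}\binom{n}{i}\frac{S_{a,b}(i)}{(ab)^i}+\frac{1}{n+1}\left(\frac{B_{n+1}(ab)}{(ab)^n}-\frac{B_{n+1}(a)}{a^n}-\frac{B_{n+1}(b)}{b^n}-B_{n+1}\cdot\left(\frac{1}{(ab)^n}-\frac{1}{a^n}-\frac{1}{b^n}\right)\right),$$ where in the last term $B_{n+1}$ is the Bernoulli number multiplied by the expression in parentheses.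
   Context: For coprime positive integers $a,b$, $S_{a,b}=\{ua+vb:\ u,v\in\mathbb{Z}_{\ge 0}\}$ is the numerical semigroup generated by $a,b$, and $C_{a,b}:=\mathbb{Z}_{\ge 0}\setminus S_{a,b}$ is its (finite) complement. The Sylvester sums are $S_{a,b}(m):=\sum_{k\in C_{a,b}}k^m$. The Bernoulli polynomials are $B_n(x)=\sum_{i=0}^n\binom{n}{i}B_ix^{n-i}$ with Bernoulli numbers $B_n=B_n(0)$.
   Formalization: The x=0 formula is false as printed (a=2, b=3, n=1: left 2, right 13/6); it is corrected: the sum with S_{a,b}(i) runs over 0≤i≤n-1, and the term 0^n/(ab)^n (1 if n=0, else 0) is added. -}

module Defs where

open import Algebra.Bundles using (CommutativeRing)
open import Algebra.Morphism.Structures using (module RingMorphisms)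
import Algebra.Morphism.Construct.Identity as Identity
import Algebra.Properties.Semiring.Exp as SemiringExp
import Algebra.Properties.Semiring.Sum as SemiringSum
open import Data.Fin.Base using (toℕ)
open import Data.Integer.Base using (+_)
open import Data.List.Base using (List; filter; map; upTo)
open import Data.List.Membership.Propositional using (_∈_)
open import Data.List.Membership.Propositional.Properties using (∈-filter⁺; ∈-filter⁻; ∈-upTo⁺)
open import Data.List.Relation.Unary.Unique.Propositional using (Unique)
import Data.List.Relation.Unary.Unique.Propositional.Properties as Unique
open import Data.Nat.Base as ℕ using (ℕ; zero; suc; _∸_; s≤s; NonZero)
open import Data.Nat.Combinatorics using (_C_)
open import Data.Nat.Coprimality using (Coprime; coprime-Bézout)
open import Data.Nat.Divisibility using (_∣_; divides; ∣m+n∣m⇒∣n)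
open import Data.Nat.DivMod using (_%_; m≡m%n+[m/n]*n; m%n<n)
open import Data.Nat.GCD using (module Bézout)
open import Data.Nat.ListAction using (sum)
import Data.Nat.Properties as ℕ
open import Data.Nat.Solver using (module +-*-Solver)
open import Data.Product.Base using (_×_; _,_; proj₂; ∃₂)
open import Data.Rational.Base as ℚ using (ℚ; 1ℚ)
import Data.Rational.Properties as ℚ
open import Data.Vec.Base using (Vec; []; _∷ʳ_; lookup)
open import Function.Base using (id)
open import Function.Bundles using (_⇔_; mk⇔)
open import Level using (Level; 0ℓ) renaming (suc to lsuc; _⊔_ to _⊔ˡ_)
open import Relation.Binary.PropositionalEquality using (_≡_; refl; sym; trans; cong; subst; module ≡-Reasoning)
open import Relation.Nullary using (¬_; Dec)
open import Relation.Nullary.Decidable using (map′; ¬?)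

------------------------------------------------------------------------
-- The numerical semigroup generated by a and b, and its complement

_∈⟨_,_⟩ : ℕ → ℕ → ℕ → Set
k ∈⟨ a , b ⟩ = ∃₂ λ u v → k ≡ u ℕ.* a ℕ.+ v ℕ.* b

_∈⟨_,_⟩? : ∀ k a b .{{_ : NonZero a}} .{{_ : NonZero b}} → Dec (k ∈⟨ a , b ⟩)
k ∈⟨ a , b ⟩? = map′
  (λ (u , _ , v , _ , eq) → u , v , eq)
  (λ (u , v , eq) →
      u , s≤s (ℕ.≤-trans (ℕ.m≤m*n u a) (ℕ.≤-trans (ℕ.m≤m+n _ (v ℕ.* b)) (ℕ.≤-reflexive (sym eq))))
    , v , s≤s (ℕ.≤-trans (ℕ.m≤m*n v b) (ℕ.≤-trans (ℕ.m≤n+m _ (u ℕ.* a)) (ℕ.≤-reflexive (sym eq))))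
    , eq)
  (ℕ.anyUpTo? (λ u → ℕ.anyUpTo? (λ v → k ℕ.≟ u ℕ.* a ℕ.+ v ℕ.* b) (suc k)) (suc k))

-- For coprime a and b every k ≥ ab lies in the semigroup (≥ab⇒∈ below), so
-- searching below ab finds the whole complement: see ∈-gaps and gaps-unique.
gaps : ∀ a b .{{_ : NonZero a}} .{{_ : NonZero b}} → List ℕ
gaps a b = filter (λ k → ¬? (k ∈⟨ a , b ⟩?)) (upTo (a ℕ.* b))

sylvesterSum : ∀ a b .{{_ : NonZero a}} .{{_ : NonZero b}} → ℕ → ℕ
sylvesterSum a b m = sum (map (ℕ._^ m) (gaps a b))

private
  ∈-from-inverse : ∀ a b .{{_ : NonZero a}} .{{_ : NonZero b}} x y →
                   1 ℕ.+ y ℕ.* b ≡ x ℕ.* a →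
                   ∀ k → a ℕ.* b ℕ.≤ k → k ∈⟨ a , b ⟩
  ∈-from-inverse a b x y eq k ab≤k = u , v , trans (sym d-eq) (cong (u ℕ.* a ℕ.+_) v-eq)
    where
    open ≡-Reasoning
    open +-*-Solver using (solve; _:+_; _:*_; _:=_; con)
    u = (x ℕ.* k) % b
    q = (x ℕ.* k) ℕ./ b
    d = k ∸ u ℕ.* a
    ua≤k : u ℕ.* a ℕ.≤ k
    ua≤k = ℕ.≤-trans (ℕ.*-monoˡ-≤ a (ℕ.<⇒≤ (m%n<n (x ℕ.* k) b)))
             (ℕ.≤-trans (ℕ.≤-reflexive (ℕ.*-comm b a)) ab≤k)
    d-eq : u ℕ.* a ℕ.+ d ≡ k
    d-eq = ℕ.m+[n∸m]≡n ua≤k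
    total : u ℕ.* a ℕ.+ (y ℕ.* k ℕ.* b ℕ.+ d) ≡ u ℕ.* a ℕ.+ q ℕ.* a ℕ.* b
    total = begin
      u ℕ.* a ℕ.+ (y ℕ.* k ℕ.* b ℕ.+ d)
        ≡⟨ solve 5 (λ s y k b d → s :+ (y :* k :* b :+ d) := (s :+ d) :+ y :* b :* k) refl (u ℕ.* a) y k b d ⟩
      (u ℕ.* a ℕ.+ d) ℕ.+ y ℕ.* b ℕ.* k
        ≡⟨ cong (ℕ._+ y ℕ.* b ℕ.* k) d-eq ⟩
      (1 ℕ.+ y ℕ.* b) ℕ.* k
        ≡⟨ cong (ℕ._* k) eq ⟩
      x ℕ.* a ℕ.* k
        ≡⟨ solve 3 (λ x a k → x :* a :* k := x :* k :* a) refl x a k ⟩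
      x ℕ.* k ℕ.* a
        ≡⟨ cong (ℕ._* a) (m≡m%n+[m/n]*n (x ℕ.* k) b) ⟩
      (u ℕ.+ q ℕ.* b) ℕ.* a
        ≡⟨ solve 4 (λ u q a b → (u :+ q :* b) :* a := u :* a :+ q :* a :* b) refl u q a b ⟩
      u ℕ.* a ℕ.+ q ℕ.* a ℕ.* b ∎
    b∣d : b ∣ d
    b∣d = ∣m+n∣m⇒∣n (divides (q ℕ.* a) (ℕ.+-cancelˡ-≡ (u ℕ.* a) _ _ total))
                    (divides (y ℕ.* k) refl)
    v = _∣_.quotient b∣d
    v-eq : d ≡ v ℕ.* b
    v-eq = _∣_.equality b∣d

≥ab⇒∈ : ∀ a b .{{_ : NonZero a}} .{{_ : NonZero b}} → Coprime a b →
        ∀ k → a ℕ.* b ℕ.≤ k → k ∈⟨ a , b ⟩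
≥ab⇒∈ a b coprime k ab≤k with coprime-Bézout coprime
... | Bézout.+- x y eq = ∈-from-inverse a b x y eq k ab≤k
... | Bézout.-+ x y eq with ∈-from-inverse b a y x eq k (subst (ℕ._≤ k) (ℕ.*-comm a b) ab≤k)
...   | u , v , k≡ = v , u , trans k≡ (ℕ.+-comm (u ℕ.* b) (v ℕ.* a))

∈-gaps : ∀ a b .{{_ : NonZero a}} .{{_ : NonZero b}} → Coprime a b →
         ∀ k → k ∈ gaps a b ⇔ (¬ k ∈⟨ a , b ⟩)
∈-gaps a b coprime k = mk⇔
  (λ k∈ → proj₂ (∈-filter⁻ P? {xs = upTo (a ℕ.* b)} k∈))
  (λ k∉ → ∈-filter⁺ P? (∈-upTo⁺ (ℕ.≰⇒> (λ ab≤k → k∉ (≥ab⇒∈ a b coprime k ab≤k)))) k∉)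
  where
  P? = λ k → ¬? (k ∈⟨ a , b ⟩?)

gaps-unique : ∀ a b .{{_ : NonZero a}} .{{_ : NonZero b}} → Unique (gaps a b)
gaps-unique a b = Unique.filter⁺ (λ k → ¬? (k ∈⟨ a , b ⟩?)) (Unique.upTo⁺ (a ℕ.* b))

------------------------------------------------------------------------
-- Commutative ℚ-algebras
--
-- An identity in a variable x with rational coefficients is stated for every
-- element x of every commutative ℚ-algebra; the case of ℚ[x] is the identity
-- of polynomials.

record ℚAlgebra (c ℓ : Level) : Set (lsuc (c ⊔ˡ ℓ)) where
  infixl 7 _/_ _/[_^_]
  field
    commutativeRing : CommutativeRing c ℓ

  open CommutativeRing commutativeRing public
  open RingMorphisms ℚ.+-*-rawRing rawRing using (IsRingHomomorphism)

  field
    ι                    : ℚ → Carrier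
    ι-isRingHomomorphism : IsRingHomomorphism ι

  open SemiringExp semiring public using (_^_)
  open SemiringSum semiring public using (sum-syntax; sum⁺-syntax)

  fromℕ : ℕ → Carrier
  fromℕ k = ι (+ k ℚ./ 1)

  _/_ : Carrier → (d : ℕ) → .{{NonZero d}} → Carrier
  y / d = ι (+ 1 ℚ./ d) * y

  _/[_^_] : Carrier → (d k : ℕ) → .{{NonZero d}} → Carrier
  y /[ d ^ k ] = _/_ y (d ℕ.^ k) {{ℕ.m^n≢0 d k}}

ℚ-algebra : ℚAlgebra 0ℓ 0ℓ
ℚ-algebra = record
  { commutativeRing      = ℚ.+-*-commutativeRing
  ; ι                    = id
  ; ι-isRingHomomorphism = Identity.isRingHomomorphism ℚ.+-*-rawRing refl
  }

instance
  m*n-nonZero : ∀ {m n} .{{_ : NonZero m}} .{{_ : NonZero n}} → NonZero (m ℕ.* n)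
  m*n-nonZero {m} {n} = ℕ.m*n≢0 m n

------------------------------------------------------------------------
-- Bernoulli numbers and polynomials

-- B₀ = 1 and ∑_{i ≤ n} C(n+1, i) Bᵢ = 0 for n ≥ 1, solved for Bₙ; this is the
-- convention t/(eᵗ - 1) = ∑ Bₙ tⁿ/n!, with B₁ = -1/2.
nextBernoulli : ∀ {n} → Vec ℚ n → ℚ
nextBernoulli {zero}  _  = 1ℚ
nextBernoulli {suc n} bs = - (∑[ i ≤ n ] (fromℕ (suc (suc n) C toℕ i) * lookup bs i)) / suc (suc n)
  where open ℚAlgebra ℚ-algebra

firstBernoullis : ∀ n → Vec ℚ n
firstBernoullis zero    = []
firstBernoullis (suc n) = firstBernoullis n ∷ʳ nextBernoulli (firstBernoullis n)

bernoulli : ℕ → ℚ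
bernoulli n = nextBernoulli (firstBernoullis n)

module _ {c ℓ} (A : ℚAlgebra c ℓ) where
  open ℚAlgebra A

  bernoulliPoly : ℕ → Carrier → Carrier
  bernoulliPoly n x = ∑[ i ≤ n ] (fromℕ (n C toℕ i) * ι (bernoulli (toℕ i)) * x ^ (n ∸ toℕ i))

{-# OPTIONS --safe #-}
module Submission where

open import Algebra.Morphism.Structures using (module RingMorphisms)
import Algebra.Properties.CommutativeSemiring.Exp as CommutativeExp
import Algebra.Properties.Semiring.Exp as Exp
import Algebra.Properties.Semiring.Sum as Sum
import Algebra.Solver.Ring as RingSolver
open import Algebra.Solver.Ring.AlmostCommutativeRing using (fromCommutativeRing; _-Raw-AlmostCommutative⟶_)
open import Data.Fin.Base as Fin using (Fin; toℕ; fromℕ<)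
import Data.Fin.Properties as Fin
open import Data.Fin.Relation.Unary.Top using (view; ‵fromℕ; ‵inject₁)
open import Data.Integer.Base as ℤ using (+_)
import Data.Integer.Properties as ℤ
open import Data.List.Base using (List; []; _∷_; _++_; allFin; applyUpTo; cartesianProductWith; foldr; map; tabulate; upTo)
open import Data.List.Membership.Propositional using (_∈_)
open import Data.List.Membership.Propositional.Properties
  using (∈-++⁺ˡ; ∈-++⁺ʳ; ∈-++⁻; ∈-allFin; ∈-map⁺; ∈-map⁻; ∈-upTo⁺; ∈-upTo⁻; ∈-cartesianProductWith⁺; ∈-cartesianProductWith⁻)
open import Data.List.Membership.Propositional.Properties.WithK using (unique∧set⇒bag)
open import Data.List.Relation.Binary.BagAndSetEquality using (∼bag⇒↭)
open import Data.List.Relation.Binary.Permutation.Propositional as ↭ using (_↭_)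
open import Data.List.Relation.Unary.Unique.Propositional using (Unique)
import Data.List.Relation.Unary.Unique.Propositional.Properties as Unique
open import Data.Maybe.Base as Maybe using (Maybe)
open import Data.Nat.Base as ℕ using (ℕ; zero; suc; pred; _∸_; NonZero)
open import Data.Nat.Combinatorics using (_C_; nCn≡1; nC1≡n; nCk≡nC[n∸k]; k>n⇒nCk≡0; nCk+nC[k+1]≡[n+1]C[k+1])
open import Data.Nat.Coprimality as Coprime using (Coprime; coprime-divisor)
open import Data.Nat.Divisibility using (divides; ∣⇒≤)
open import Data.Nat.DivMod using (_%_; m≡m%n+[m/n]*n; m%n<n)
open import Data.Nat.ListAction using (sum)
import Data.Nat.Properties as ℕ
open import Data.Nat.Tactic.RingSolver using (solve-∀)
open import Data.Product.Base using (_×_; _,_; ∃₂)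
open import Data.Rational.Base as ℚ using (ℚ)
import Data.Rational.Properties as ℚ
open import Data.Rational.Unnormalised.Base as ℚᵘ using (mkℚᵘ; *≡*)
import Data.Rational.Unnormalised.Properties as ℚᵘ
open import Data.Sum.Base using (inj₁; inj₂)
open import Data.Vec.Base using (Vec; []; _∷_; _∷ʳ_; lookup)
open import Function.Base using (_∘_)
open import Function.Bundles using (mk⇔; Equivalence)
open import Relation.Binary.PropositionalEquality as ≡ using (_≡_)
import Relation.Binary.Reasoning.Setoid as SetoidReasoning
open import Relation.Nullary using (¬_; yes; no)
open import Relation.Nullary.Decidable using (dec⇒maybe)
open import Defs

-- As i and j run through 0 ≤ i < b and 0 ≤ j < a, the numbers ia + jb hit every
-- residue mod ab once: at its least representative if that lies in the semigroup,
-- and at ab plus it if it is a gap.  Hence summing F k = (x + k)ⁿ gives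
--   ∑ᵢ∑ⱼ F(ia + jb) = ∑_{k < ab} F k + ∑_{g gap} (F(ab + g) - F g).
-- The border terms i = 0 and j = 0, and the sum over k < ab, are power sums over
-- progressions, i.e. differences of Bernoulli polynomials; the sum over the gaps
-- is expanded by the binomial theorem.

-- The shift by `ab` is not argued through residues. Adding the gaps to both sides turns the claim
-- into a permutation of two duplicate-free lists, for which equal membership is enough: nothing has
-- to be deleted from a list and no map inverted. Coprimality enters in two ways: every number from
-- `ab` on is representable, and a representation whose first coefficient is below `b` has the least
-- possible first coefficient.
--
-- The Bernoulli differences come from t/(e^t - 1) alone. Sequences are read as exponential
-- generating functions, and their product is defined by the Leibniz rule, where dropping the first
-- term plays the role of d/dt. Its laws are then plain inductions without binomial coefficients;
-- Pascal's rule is used once, to expand the product. The same expansion serves the gaps, because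
-- the Sylvester sums have as generating function the sum of e^(gt) over the gaps g.

module _ where
  open ≡ using (refl; sym; trans; cong; cong₂; subst)

  -- Representations ua + vb with u below b.

  module _ {a b : ℕ} .{{_ : NonZero a}} .{{_ : NonZero b}} (coprime : Coprime a b) where

    -- If u < i, then (i - u)a = (v - j)b, so by coprimality b divides i - u, a positive number
    -- below b. The coefficient u is left unbounded, since the bound is also applied to arbitrary
    -- representations.
    coefficient-≤ : ∀ i j u v → i ℕ.< b → i ℕ.* a ℕ.+ j ℕ.* b ≡ u ℕ.* a ℕ.+ v ℕ.* b → i ℕ.≤ u
    coefficient-≤ i j u v i<b eq = ℕ.≮⇒≥ λ u<i →
      let d    = i ∸ u
          u+d  : u ℕ.+ d ≡ i
          u+d  = ℕ.m+[n∸m]≡n (ℕ.<⇒≤ u<i)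
          eq′  : a ℕ.* d ℕ.+ j ℕ.* b ≡ v ℕ.* b
          eq′  = ℕ.+-cancelˡ-≡ (u ℕ.* a) _ _
                   (trans (trans (lemma u a d (j ℕ.* b)) (cong (λ z → z ℕ.* a ℕ.+ j ℕ.* b) u+d)) eq)
          eq″  : a ℕ.* d ≡ (v ∸ j) ℕ.* b
          eq″  = trans (sym (ℕ.m+n∸n≡m _ (j ℕ.* b)))
                   (trans (cong (_∸ j ℕ.* b) eq′) (sym (ℕ.*-distribʳ-∸ b v j)))
          b∣d  = coprime-divisor (Coprime.sym coprime) (divides (v ∸ j) eq″)
          b≤d  = ∣⇒≤ {{ℕ.>-nonZero (ℕ.m<n⇒0<n∸m u<i)}} b∣d
      in ℕ.<⇒≱ i<b (ℕ.≤-trans b≤d (ℕ.m∸n≤m i u))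
      where
      lemma : ∀ u a d c → u ℕ.* a ℕ.+ (a ℕ.* d ℕ.+ c) ≡ (u ℕ.+ d) ℕ.* a ℕ.+ c
      lemma = solve-∀

    coefficients-unique : ∀ i j i′ j′ → i ℕ.< b → i′ ℕ.< b →
                          i ℕ.* a ℕ.+ j ℕ.* b ≡ i′ ℕ.* a ℕ.+ j′ ℕ.* b → i ≡ i′ × j ≡ j′
    coefficients-unique i j i′ j′ i<b i′<b eq
      with refl ← ℕ.≤-antisym (coefficient-≤ i j i′ j′ i<b eq) (coefficient-≤ i′ j′ i j i′<b (sym eq)) =
      refl , ℕ.*-cancelʳ-≡ j j′ b (ℕ.+-cancelˡ-≡ (i ℕ.* a) _ _ eq)

  -- Multiples of b in the first coefficient are traded for multiples of a in the second: (qb)a =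
  -- (qa)b.
  reduce-coefficient : ∀ {a b k} .{{_ : NonZero b}} → k ∈⟨ a , b ⟩ →
                       ∃₂ λ u v → u ℕ.< b × k ≡ u ℕ.* a ℕ.+ v ℕ.* b
  reduce-coefficient {a} {b} (u , v , eq) = u % b , v ℕ.+ u ℕ./ b ℕ.* a , m%n<n u b ,
    trans eq (trans (cong (λ z → z ℕ.* a ℕ.+ v ℕ.* b) (m≡m%n+[m/n]*n u b)) (lemma (u % b) (u ℕ./ b) a b v))
    where
    lemma : ∀ r q a b v → (r ℕ.+ q ℕ.* b) ℕ.* a ℕ.+ v ℕ.* b ≡ r ℕ.* a ℕ.+ (v ℕ.+ q ℕ.* a) ℕ.* b
    lemma = solve-∀

  -- The values on the box, compared with the interval below ab.

  boxValue : ∀ a b → Fin b → Fin a → ℕ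
  boxValue a b i j = toℕ i ℕ.* a ℕ.+ toℕ j ℕ.* b

  boxValues : ∀ a b → List ℕ
  boxValues a b = cartesianProductWith (boxValue a b) (allFin b) (allFin a)

  ∈-boxValues⁺ : ∀ {a b} u v → u ℕ.< b → v ℕ.< a → u ℕ.* a ℕ.+ v ℕ.* b ∈ boxValues a b
  ∈-boxValues⁺ {a} {b} u v u<b v<a = subst (_∈ boxValues a b)
    (cong₂ (λ u v → u ℕ.* a ℕ.+ v ℕ.* b) (Fin.toℕ-fromℕ< u<b) (Fin.toℕ-fromℕ< v<a))
    (∈-cartesianProductWith⁺ (boxValue a b) (∈-allFin (fromℕ< u<b)) (∈-allFin (fromℕ< v<a)))

  ∈-boxValues⁻ : ∀ a b {k} → k ∈ boxValues a b →
                 ∃₂ λ u v → u ℕ.< b × v ℕ.< a × k ≡ u ℕ.* a ℕ.+ v ℕ.* b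
  ∈-boxValues⁻ a b k∈ with i , j , _ , _ , eq ← ∈-cartesianProductWith⁻ (boxValue a b) (allFin b) (allFin a) k∈ =
    toℕ i , toℕ j , Fin.toℕ<n i , Fin.toℕ<n j , eq

  -- Neither list repeats an element: coefficients in the box are unique, a box value is
  -- representable and hence no gap, and a shifted gap is at least `ab`. Comparing members therefore
  -- suffices.
  boxValues++gaps↭ : ∀ a b .{{_ : NonZero a}} .{{_ : NonZero b}} → Coprime a b →
    boxValues a b ++ gaps a b ↭ upTo (a ℕ.* b) ++ map (a ℕ.* b ℕ.+_) (gaps a b)
  boxValues++gaps↭ a b coprime = ∼bag⇒↭ (unique∧set⇒bag
    (Unique.++⁺ box-unique (gaps-unique a b) λ (k∈box , k∈gaps) →
      let u , v , _ , _ , eq = ∈-boxValues⁻ a b k∈box in ∈-gaps⁻ k∈gaps (u , v , eq))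
    (Unique.++⁺ (Unique.upTo⁺ ab) (Unique.map⁺ (ℕ.+-cancelˡ-≡ ab _ _) (gaps-unique a b)) λ (k∈upTo , k∈map) →
      let g , _ , eq = ∈-map⁻ (ab ℕ.+_) k∈map in
      ℕ.<⇒≱ (∈-upTo⁻ k∈upTo) (subst (ab ℕ.≤_) (sym eq) (ℕ.m≤m+n ab g)))
    (mk⇔ to from))
    where
    ab = a ℕ.* b
    ∈-gaps⁺ : ∀ {k} → ¬ k ∈⟨ a , b ⟩ → k ∈ gaps a b
    ∈-gaps⁺ = Equivalence.from (∈-gaps a b coprime _)
    ∈-gaps⁻ : ∀ {k} → k ∈ gaps a b → ¬ k ∈⟨ a , b ⟩
    ∈-gaps⁻ = Equivalence.to (∈-gaps a b coprime _)
    gap<ab : ∀ {k} → k ∈ gaps a b → k ℕ.< ab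
    gap<ab {k} k∈ = ℕ.≰⇒> (λ ab≤k → ∈-gaps⁻ k∈ (≥ab⇒∈ a b coprime k ab≤k))

    box-unique : Unique (boxValues a b)
    box-unique = Unique.cartesianProductWith⁺ (boxValue a b)
      (λ {w} {x} {y} {z} eq →
        let i≡ , j≡ = coefficients-unique {a} {b} coprime (toℕ w) (toℕ y) (toℕ x) (toℕ z) (Fin.toℕ<n w) (Fin.toℕ<n x) eq
        in Fin.toℕ-injective i≡ , Fin.toℕ-injective j≡)
      (Unique.allFin⁺ b) (Unique.allFin⁺ a)

    shift : ∀ u v → ab ℕ.+ (u ℕ.* a ℕ.+ v ℕ.* b) ≡ u ℕ.* a ℕ.+ (a ℕ.+ v) ℕ.* b
    shift u v = lemma a b u v
      where
      lemma : ∀ a b u v → a ℕ.* b ℕ.+ (u ℕ.* a ℕ.+ v ℕ.* b) ≡ u ℕ.* a ℕ.+ (a ℕ.+ v) ℕ.* b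
      lemma = solve-∀

    to : ∀ {k} → k ∈ boxValues a b ++ gaps a b → k ∈ upTo ab ++ map (ab ℕ.+_) (gaps a b)
    to {k} k∈ with ∈-++⁻ (boxValues a b) k∈
    ... | inj₂ k∈gaps = ∈-++⁺ˡ (∈-upTo⁺ (gap<ab k∈gaps))
    ... | inj₁ k∈box with k ℕ.<? ab
    ...   | yes k<ab = ∈-++⁺ˡ (∈-upTo⁺ k<ab)
    -- Were k - ab = ua + vb, then k = ua + (a + v)b. Minimality gives i ≤ u, which forces a + v ≤ j
    -- < a.
    ...   | no k≮ab with i , j , i<b , j<a , eq ← ∈-boxValues⁻ a b k∈box =
      ∈-++⁺ʳ (upTo ab) (subst (_∈ map (ab ℕ.+_) (gaps a b)) (ℕ.m+[n∸m]≡n ab≤k)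
        (∈-map⁺ (ab ℕ.+_) (∈-gaps⁺ λ (u , v , eq′) →
          let eq″ : i ℕ.* a ℕ.+ j ℕ.* b ≡ u ℕ.* a ℕ.+ (a ℕ.+ v) ℕ.* b
              eq″ = trans (sym eq) (trans (sym (ℕ.m+[n∸m]≡n ab≤k)) (trans (cong (ab ℕ.+_) eq′) (shift u v)))
              i≤u = coefficient-≤ {a} {b} coprime i j u (a ℕ.+ v) i<b eq″
              a+v≤j : a ℕ.+ v ℕ.≤ j
              a+v≤j = ℕ.*-cancelʳ-≤ (a ℕ.+ v) j b (ℕ.+-cancelˡ-≤ (i ℕ.* a) _ _
                (ℕ.≤-trans (ℕ.+-monoˡ-≤ _ (ℕ.*-monoˡ-≤ a i≤u)) (ℕ.≤-reflexive (sym eq″))))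
          in ℕ.<⇒≱ j<a (ℕ.≤-trans (ℕ.m≤m+n a v) a+v≤j))))
      where ab≤k = ℕ.≮⇒≥ k≮ab

    from : ∀ {k} → k ∈ upTo ab ++ map (ab ℕ.+_) (gaps a b) → k ∈ boxValues a b ++ gaps a b
    from {k} k∈ with ∈-++⁻ (upTo ab) k∈
    from {k} k∈ | inj₁ k∈upTo with k ∈⟨ a , b ⟩?
    ... | no k∉ = ∈-++⁺ʳ (boxValues a b) (∈-gaps⁺ k∉)
    -- Below `ab` there is no room for u ≥ b or v ≥ a, so any representation already lies in the
    -- box.
    ... | yes (u , v , refl) = ∈-++⁺ˡ (∈-boxValues⁺ u v
      (ℕ.*-cancelʳ-< a u b (ℕ.<-≤-trans (ℕ.≤-<-trans (ℕ.m≤m+n _ _) k<ab) (ℕ.≤-reflexive (ℕ.*-comm a b))))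
      (ℕ.*-cancelʳ-< b v a (ℕ.≤-<-trans (ℕ.m≤n+m _ _) k<ab)))
      where k<ab = ∈-upTo⁻ k∈upTo
    -- `ab + g` is representable because it is at least `ab`. With u < b arranged, v ≥ a would give
    -- g = ua + (v - a)b, although g is a gap.
    from {k} k∈ | inj₂ k∈map
      with g , g∈ , refl ← ∈-map⁻ (ab ℕ.+_) k∈map
      with u , v , u<b , eq ← reduce-coefficient {a} {b} (≥ab⇒∈ a b coprime (ab ℕ.+ g) (ℕ.m≤m+n ab g)) =
      ∈-++⁺ˡ (subst (_∈ boxValues a b) (sym eq) (∈-boxValues⁺ u v u<b (ℕ.≰⇒> λ a≤v →
        ∈-gaps⁻ g∈ (u , v ∸ a , ℕ.+-cancelˡ-≡ ab _ _
          (trans eq (trans (cong (λ z → u ℕ.* a ℕ.+ z ℕ.* b) (sym (ℕ.m+[n∸m]≡n a≤v))) (sym (shift u (v ∸ a)))))))))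

  -- Stored Bernoulli numbers, and arithmetic of fractions.

  lookup-∷ʳ-fromℕ : ∀ {a} {A : Set a} {n} (xs : Vec A n) x → lookup (xs ∷ʳ x) (Fin.fromℕ n) ≡ x
  lookup-∷ʳ-fromℕ []       x = refl
  lookup-∷ʳ-fromℕ (_ ∷ xs) x = lookup-∷ʳ-fromℕ xs x

  lookup-∷ʳ-inject₁ : ∀ {a} {A : Set a} {n} (xs : Vec A n) x i → lookup (xs ∷ʳ x) (Fin.inject₁ i) ≡ lookup xs i
  lookup-∷ʳ-inject₁ (_ ∷ xs) x Fin.zero    = refl
  lookup-∷ʳ-inject₁ (_ ∷ xs) x (Fin.suc i) = lookup-∷ʳ-inject₁ xs x i

  -- `firstBernoullis` grows only at its end, so an entry keeps its position once appended. This
  -- turns the entries read by `nextBernoulli` into values of `bernoulli`.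
  lookup-firstBernoullis : ∀ n (i : Fin n) → lookup (firstBernoullis n) i ≡ bernoulli (toℕ i)
  lookup-firstBernoullis (suc n) i with view i
  ... | ‵fromℕ     = trans (lookup-∷ʳ-fromℕ (firstBernoullis n) _) (cong bernoulli (sym (Fin.toℕ-fromℕ n)))
  ... | ‵inject₁ j = trans (lookup-∷ʳ-inject₁ (firstBernoullis n) _ j)
    (trans (lookup-firstBernoullis n j) (cong bernoulli (sym (Fin.toℕ-inject₁ j))))

  -- Reduction to lowest terms blocks computation with variable numerators. In `ℚᵘ` the operations
  -- are the schoolbook formulas, and `toℚᵘ` reflects equality.
  fromℚᵘ-homo-+ : ∀ p q → ℚ.fromℚᵘ (p ℚᵘ.+ q) ≡ ℚ.fromℚᵘ p ℚ.+ ℚ.fromℚᵘ q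
  fromℚᵘ-homo-+ p q = ℚ.toℚᵘ-injective (ℚᵘ.≃-trans (ℚ.toℚᵘ-fromℚᵘ (p ℚᵘ.+ q)) (ℚᵘ.≃-sym
    (ℚᵘ.≃-trans (ℚ.toℚᵘ-homo-+ (ℚ.fromℚᵘ p) (ℚ.fromℚᵘ q)) (ℚᵘ.+-cong (ℚ.toℚᵘ-fromℚᵘ p) (ℚ.toℚᵘ-fromℚᵘ q)))))

  fromℚᵘ-homo-* : ∀ p q → ℚ.fromℚᵘ (p ℚᵘ.* q) ≡ ℚ.fromℚᵘ p ℚ.* ℚ.fromℚᵘ q
  fromℚᵘ-homo-* p q = ℚ.toℚᵘ-injective (ℚᵘ.≃-trans (ℚ.toℚᵘ-fromℚᵘ (p ℚᵘ.* q)) (ℚᵘ.≃-sym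
    (ℚᵘ.≃-trans (ℚ.toℚᵘ-homo-* (ℚ.fromℚᵘ p) (ℚ.fromℚᵘ q)) (ℚᵘ.*-cong (ℚ.toℚᵘ-fromℚᵘ p) (ℚ.toℚᵘ-fromℚᵘ q)))))

  fraction-homo-+ : ∀ m n → + (m ℕ.+ n) ℚ./ 1 ≡ + m ℚ./ 1 ℚ.+ + n ℚ./ 1
  fraction-homo-+ m n = trans
    (ℚ.fromℚᵘ-cong {mkℚᵘ (+ (m ℕ.+ n)) 0} {mkℚᵘ (+ m) 0 ℚᵘ.+ mkℚᵘ (+ n) 0}
      (*≡* (cong (ℤ._* + 1) (trans (ℤ.pos-+ m n)
        (cong₂ ℤ._+_ (sym (ℤ.*-identityʳ (+ m))) (sym (ℤ.*-identityʳ (+ n))))))))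
    (fromℚᵘ-homo-+ (mkℚᵘ (+ m) 0) (mkℚᵘ (+ n) 0))

  fraction-homo-* : ∀ m n → + (m ℕ.* n) ℚ./ 1 ≡ + m ℚ./ 1 ℚ.* (+ n ℚ./ 1)
  fraction-homo-* m n = trans
    (ℚ.fromℚᵘ-cong {mkℚᵘ (+ (m ℕ.* n)) 0} {mkℚᵘ (+ m) 0 ℚᵘ.* mkℚᵘ (+ n) 0}
      (*≡* (cong (ℤ._* + 1) (ℤ.pos-* m n))))
    (fromℚᵘ-homo-* (mkℚᵘ (+ m) 0) (mkℚᵘ (+ n) 0))

  fraction-inverse : ∀ d .{{_ : NonZero d}} → + d ℚ./ 1 ℚ.* (+ 1 ℚ./ d) ≡ ℚ.1ℚ
  fraction-inverse (suc d) = trans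
    (sym (fromℚᵘ-homo-* (mkℚᵘ (+ suc d) 0) (mkℚᵘ (+ 1) d)))
    (ℚ.fromℚᵘ-cong {mkℚᵘ (+ suc d) 0 ℚᵘ.* mkℚᵘ (+ 1) d} {mkℚᵘ (+ 1) 0}
      (*≡* (cong +_ (lemma d))))
    where
    lemma : ∀ d → suc d ℕ.* 1 ℕ.* 1 ≡ 1 ℕ.* (1 ℕ.* suc d)
    lemma d = trans (ℕ.*-identityʳ _) (trans (ℕ.*-identityʳ _) (sym (trans (ℕ.*-identityˡ _) (ℕ.*-identityˡ _))))

-- Computation in a commutative ℚ-algebra: solver, natural numbers, division.

module Algebraic {c ℓ} (A : ℚAlgebra c ℓ) where
  open ℚAlgebra A
  open SetoidReasoning setoid
  open Sum semiring
    using (sum-cong-≋; ∑-distrib-+; *-distribˡ-sum)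
  open Exp semiring using (^-congˡ; ^-congʳ)
  open CommutativeExp commutativeSemiring using (^-distrib-*)
  open RingMorphisms.IsRingHomomorphism ι-isRingHomomorphism
    using () renaming (⟦⟧-cong to ι-cong; +-homo to ι-+; *-homo to ι-*; -‿homo to ι-neg; 0#-homo to ι-0; 1#-homo to ι-1)

  coefficients : ℚ.+-*-rawRing -Raw-AlmostCommutative⟶ fromCommutativeRing commutativeRing
  coefficients = record
    { ⟦_⟧ = ι ; +-homo = ι-+ ; *-homo = ι-* ; -‿homo = ι-neg ; 0-homo = ι-0 ; 1-homo = ι-1 }

  -- Equality is decided in `ℚ`, since it need not be decidable in `Carrier`. Distinct rationals
  -- give no answer: `ι` is not injective in the zero algebra.
  coefficient-≟ : ∀ p q → Maybe (ι p ≈ ι q)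
  coefficient-≟ p q = Maybe.map ι-cong (dec⇒maybe (p ℚ.≟ q))

  module Solver = RingSolver ℚ.+-*-rawRing (fromCommutativeRing commutativeRing) coefficients coefficient-≟
  open Solver using (solve; _:+_; _:*_; _:-_; _:=_; con)

  fromℕ-0 : fromℕ 0 ≈ 0#
  fromℕ-0 = ι-0

  fromℕ-1 : fromℕ 1 ≈ 1#
  fromℕ-1 = ι-1

  fromℕ-+ : ∀ m n → fromℕ (m ℕ.+ n) ≈ fromℕ m + fromℕ n
  fromℕ-+ m n = trans (ι-cong (fraction-homo-+ m n)) (ι-+ _ _)

  fromℕ-* : ∀ m n → fromℕ (m ℕ.* n) ≈ fromℕ m * fromℕ n
  fromℕ-* m n = trans (ι-cong (fraction-homo-* m n)) (ι-* _ _)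

  fromℕ-suc : ∀ n → fromℕ (suc n) ≈ 1# + fromℕ n
  fromℕ-suc n = trans (fromℕ-+ 1 n) (+-congʳ fromℕ-1)

  fromℕ-^ : ∀ m n → fromℕ (m ℕ.^ n) ≈ fromℕ m ^ n
  fromℕ-^ m zero    = fromℕ-1
  fromℕ-^ m (suc n) = trans (fromℕ-* m (m ℕ.^ n)) (*-congˡ (fromℕ-^ m n))

  fromℕ-cong : ∀ {m n} → m ≡ n → fromℕ m ≈ fromℕ n
  fromℕ-cong eq = reflexive (≡.cong fromℕ eq)

  *-/-cancel : ∀ d .{{_ : NonZero d}} y → fromℕ d * (y / d) ≈ y
  *-/-cancel d y = begin
    fromℕ d * (ι (+ 1 ℚ./ d) * y) ≈⟨ *-assoc _ _ _ ⟨
    fromℕ d * ι (+ 1 ℚ./ d) * y   ≈⟨ *-congʳ (trans (sym (ι-* _ _)) (trans (ι-cong (fraction-inverse d)) ι-1)) ⟩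
    1# * y                        ≈⟨ *-identityˡ y ⟩
    y                             ∎

  /-cong : ∀ d .{{_ : NonZero d}} {y z} → y ≈ z → y / d ≈ z / d
  /-cong d = *-congˡ

  -- `fromℕ d` is invertible and may be cancelled, so claims about quotients are proved by clearing
  -- the denominator.
  /-unique : ∀ d .{{_ : NonZero d}} {y z} → fromℕ d * z ≈ y → z ≈ y / d
  /-unique d {y} {z} eq = begin
    z                 ≈⟨ *-/-cancel d z ⟨
    fromℕ d * (z / d) ≈⟨ solve 3 (λ f i z → f :* (i :* z) := i :* (f :* z)) refl _ _ _ ⟩
    (fromℕ d * z) / d ≈⟨ /-cong d eq ⟩
    y / d             ∎

  -- The sequence with exponential generating function e^(xt).
  pow : Carrier → ℕ → Carrier
  pow x n = x ^ n

  1^n≈1 : ∀ n → 1# ^ n ≈ 1#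
  1^n≈1 zero    = refl
  1^n≈1 (suc n) = trans (*-identityˡ _) (1^n≈1 n)

  /-^ : ∀ d .{{_ : NonZero d}} y n → (y / d) ^ n ≈ y ^ n /[ d ^ n ]
  /-^ d y n = /-unique (d ℕ.^ n) {{ℕ.m^n≢0 d n}} (begin
    fromℕ (d ℕ.^ n) * (y / d) ^ n ≈⟨ *-congʳ (fromℕ-^ d n) ⟩
    fromℕ d ^ n * (y / d) ^ n     ≈⟨ ^-distrib-* (fromℕ d) (y / d) n ⟨
    (fromℕ d * (y / d)) ^ n       ≈⟨ ^-congˡ n (*-/-cancel d y) ⟩
    y ^ n                         ∎)

  -- Finite sums and exponential generating functions.

  ∑-last : ∀ n (f : ℕ → Carrier) → ∑[ i ≤ n ] f (toℕ i) ≈ ∑[ i < n ] f (toℕ i) + f n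
  ∑-last zero    f = +-comm _ _
  ∑-last (suc n) f = trans (+-congˡ (∑-last n (f ∘ suc))) (sym (+-assoc _ _ _))

  ∑-cong : ∀ n {f g : Fin n → Carrier} → (∀ i → f i ≈ g i) → ∑[ i < n ] f i ≈ ∑[ i < n ] g i
  ∑-cong n = sum-cong-≋ {n}

  ι-∑ : ∀ n (f : Fin n → ℚ) → ι (ℚAlgebra.sum-syntax ℚ-algebra n f) ≈ ∑[ i < n ] ι (f i)
  ι-∑ zero    f = ι-0
  ι-∑ (suc n) f = trans (ι-+ _ _) (+-congˡ (ι-∑ n (f ∘ Fin.suc)))

  -- The product of exponential generating functions.
  infixl 7 _⋆_
  _⋆_ : (ℕ → Carrier) → (ℕ → Carrier) → ℕ → Carrier
  (f ⋆ g) zero    = f 0 * g 0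
  (f ⋆ g) (suc n) = ((f ∘ suc) ⋆ g) n + (f ⋆ (g ∘ suc)) n

  ⋆-cong : ∀ {f f′ g g′} → (∀ n → f n ≈ f′ n) → (∀ n → g n ≈ g′ n) → ∀ n → (f ⋆ g) n ≈ (f′ ⋆ g′) n
  ⋆-cong p q zero    = *-cong (p 0) (q 0)
  ⋆-cong p q (suc n) = +-cong (⋆-cong (p ∘ suc) q n) (⋆-cong p (q ∘ suc) n)

  ⋆-comm : ∀ f g n → (f ⋆ g) n ≈ (g ⋆ f) n
  ⋆-comm f g zero    = *-comm _ _
  ⋆-comm f g (suc n) = trans (+-comm _ _) (+-cong (⋆-comm f (g ∘ suc) n) (⋆-comm (f ∘ suc) g n))

  ⋆-distribʳ-+ : ∀ f g h n → ((λ k → f k + g k) ⋆ h) n ≈ (f ⋆ h) n + (g ⋆ h) n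
  ⋆-distribʳ-+ f g h zero    = distribʳ _ _ _
  ⋆-distribʳ-+ f g h (suc n) = trans
    (+-cong (⋆-distribʳ-+ (f ∘ suc) (g ∘ suc) h n) (⋆-distribʳ-+ f g (h ∘ suc) n))
    (solve 4 (λ x y z w → (x :+ y) :+ (z :+ w) := (x :+ z) :+ (y :+ w)) refl _ _ _ _)

  ⋆-distribˡ-+ : ∀ f g h n → (f ⋆ (λ k → g k + h k)) n ≈ (f ⋆ g) n + (f ⋆ h) n
  ⋆-distribˡ-+ f g h n = trans (⋆-comm f _ n)
    (trans (⋆-distribʳ-+ g h f n) (+-cong (⋆-comm g f n) (⋆-comm h f n)))

  ⋆-scaleˡ : ∀ x f g n → ((λ k → x * f k) ⋆ g) n ≈ x * (f ⋆ g) n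
  ⋆-scaleˡ x f g zero    = *-assoc _ _ _
  ⋆-scaleˡ x f g (suc n) = trans
    (+-cong (⋆-scaleˡ x (f ∘ suc) g n) (⋆-scaleˡ x f (g ∘ suc) n)) (sym (distribˡ _ _ _))

  ⋆-scaleʳ : ∀ x f g n → (f ⋆ (λ k → x * g k)) n ≈ x * (f ⋆ g) n
  ⋆-scaleʳ x f g n = trans (⋆-comm f _ n) (trans (⋆-scaleˡ x g f n) (*-congˡ (⋆-comm g f n)))

  ⋆-zeroˡ : ∀ g n → ((λ _ → 0#) ⋆ g) n ≈ 0#
  ⋆-zeroˡ g zero    = zeroˡ _
  ⋆-zeroˡ g (suc n) = trans (+-cong (⋆-zeroˡ g n) (⋆-zeroˡ (g ∘ suc) n)) (+-identityˡ _)

  ⋆-assoc : ∀ f g h n → ((f ⋆ g) ⋆ h) n ≈ (f ⋆ (g ⋆ h)) n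
  ⋆-assoc f g h zero    = *-assoc _ _ _
  ⋆-assoc f g h (suc n) = begin
    ((λ k → ((f ∘ suc) ⋆ g) k + (f ⋆ (g ∘ suc)) k) ⋆ h) n + ((f ⋆ g) ⋆ (h ∘ suc)) n
      ≈⟨ +-cong (⋆-distribʳ-+ _ _ h n) (⋆-assoc f g (h ∘ suc) n) ⟩
    ((f ∘ suc) ⋆ g ⋆ h) n + (f ⋆ (g ∘ suc) ⋆ h) n + (f ⋆ (g ⋆ (h ∘ suc))) n
      ≈⟨ +-congʳ (+-cong (⋆-assoc (f ∘ suc) g h n) (⋆-assoc f (g ∘ suc) h n)) ⟩
    ((f ∘ suc) ⋆ (g ⋆ h)) n + (f ⋆ ((g ∘ suc) ⋆ h)) n + (f ⋆ (g ⋆ (h ∘ suc))) n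
      ≈⟨ +-assoc _ _ _ ⟩
    ((f ∘ suc) ⋆ (g ⋆ h)) n + ((f ⋆ ((g ∘ suc) ⋆ h)) n + (f ⋆ (g ⋆ (h ∘ suc))) n)
      ≈⟨ +-congˡ (⋆-distribˡ-+ f _ _ n) ⟨
    (f ⋆ (g ⋆ h)) (suc n) ∎

  -- This is e^(xt) e^(yt) = e^((x+y)t): differentiating either factor multiplies it by its base.
  -- Expanding the left side would give the binomial theorem.
  pow-⋆ : ∀ x y n → (pow x ⋆ pow y) n ≈ (x + y) ^ n
  pow-⋆ x y zero    = *-identityˡ _
  pow-⋆ x y (suc n) = begin
    ((λ k → x * x ^ k) ⋆ pow y) n + (pow x ⋆ (λ k → y * y ^ k)) n
      ≈⟨ +-cong (⋆-scaleˡ x _ _ n) (⋆-scaleʳ y _ _ n) ⟩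
    x * (pow x ⋆ pow y) n + y * (pow x ⋆ pow y) n ≈⟨ distribʳ _ _ _ ⟨
    (x + y) * (pow x ⋆ pow y) n                   ≈⟨ *-congˡ (pow-⋆ x y n) ⟩
    (x + y) ^ suc n                               ∎

  ⋆-expand : ∀ n f g → (f ⋆ g) n ≈ ∑[ i ≤ n ] (fromℕ (n C toℕ i) * f (toℕ i) * g (n ∸ toℕ i))
  ⋆-expand zero    f g = sym (trans (+-identityʳ _) (*-congʳ (trans (*-congʳ fromℕ-1) (*-identityˡ _))))
  ⋆-expand (suc n) f g = begin
    ((f ∘ suc) ⋆ g) n + (f ⋆ (g ∘ suc)) n
      ≈⟨ +-cong (⋆-expand n (f ∘ suc) g) (⋆-expand n f (g ∘ suc)) ⟩
    ∑[ i ≤ n ] s (toℕ i) + ∑[ i ≤ n ] (fromℕ (n C toℕ i) * f (toℕ i) * g (suc (n ∸ toℕ i)))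
      -- `suc (n ∸ i)` becomes `suc n ∸ i`, which relies on i ≤ n.
      ≈⟨ +-congˡ (∑-cong (suc n) λ i → *-congˡ {fromℕ (n C toℕ i) * f (toℕ i)} (reflexive (≡.cong g (≡.sym (ℕ.+-∸-assoc 1 (ℕ.s≤s⁻¹ (Fin.toℕ<n i))))))) ⟩
    ∑[ i ≤ n ] s (toℕ i) + ∑[ i ≤ n ] t (toℕ i)
      -- The second sum is extended by a top term that vanishes because C(n, n+1) = 0. Its first
      -- term can then be split off, which aligns the rest with the first sum for Pascal's rule.
      ≈⟨ +-congˡ (trans (∑-last (suc n) t) (trans (+-congˡ top-vanishes) (+-identityʳ _))) ⟨
    ∑[ i ≤ n ] s (toℕ i) + (t 0 + ∑[ i ≤ n ] t (suc (toℕ i)))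
      ≈⟨ solve 3 (λ x y z → x :+ (y :+ z) := y :+ (x :+ z)) refl _ _ _ ⟩
    t 0 + (∑[ i ≤ n ] s (toℕ i) + ∑[ i ≤ n ] t (suc (toℕ i)))
      ≈⟨ +-congˡ (∑-distrib-+ {suc n} (s ∘ toℕ) (t ∘ suc ∘ toℕ)) ⟨
    t 0 + ∑[ i ≤ n ] (s (toℕ i) + t (suc (toℕ i)))
      ≈⟨ +-congˡ (∑-cong (suc n) (pascal ∘ toℕ)) ⟩
    ∑[ i ≤ suc n ] (fromℕ (suc n C toℕ i) * f (toℕ i) * g (suc n ∸ toℕ i)) ∎
    where
    s t : ℕ → Carrier
    s i = fromℕ (n C i) * f (suc i) * g (n ∸ i)
    t i = fromℕ (n C i) * f i * g (suc n ∸ i)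
    top-vanishes : t (suc n) ≈ 0#
    top-vanishes = trans (*-congʳ (trans (*-congʳ (trans (fromℕ-cong (k>n⇒nCk≡0 (ℕ.n<1+n n))) fromℕ-0)) (zeroˡ _))) (zeroˡ _)
    pascal : ∀ i → s i + t (suc i) ≈ fromℕ (suc n C suc i) * f (suc i) * g (n ∸ i)
    pascal i = begin
      fromℕ (n C i) * f (suc i) * g (n ∸ i) + fromℕ (n C suc i) * f (suc i) * g (n ∸ i)
        ≈⟨ solve 4 (λ p q x y → p :* x :* y :+ q :* x :* y := (p :+ q) :* x :* y) refl _ _ _ _ ⟩
      (fromℕ (n C i) + fromℕ (n C suc i)) * f (suc i) * g (n ∸ i)
        ≈⟨ *-congʳ (*-congʳ (trans (sym (fromℕ-+ (n C i) (n C suc i))) (fromℕ-cong (nCk+nC[k+1]≡[n+1]C[k+1] n i)))) ⟩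
      fromℕ (suc n C suc i) * f (suc i) * g (n ∸ i) ∎

  -- The generating functions 1 and t.
  ε δ : ℕ → Carrier
  ε zero    = 1#
  ε (suc _) = 0#
  δ zero    = 0#
  δ (suc n) = ε n

  ε-⋆ : ∀ g n → (ε ⋆ g) n ≈ g n
  ε-⋆ g zero    = *-identityˡ _
  ε-⋆ g (suc n) = trans (+-cong (⋆-zeroˡ g n) (ε-⋆ (g ∘ suc) n)) (+-identityˡ _)

  -- The derivative of t e^(yt) is e^(yt) + y t e^(yt). The inner `step` treats n = 0 apart, and at
  -- n + 1 it calls this lemma at n.
  δ-⋆-pow : ∀ y n → (δ ⋆ pow y) (suc n) ≈ fromℕ (suc n) * y ^ n
  δ-⋆-pow y n = begin
    (ε ⋆ pow y) n + (δ ⋆ (λ k → y * y ^ k)) n ≈⟨ +-cong (ε-⋆ (pow y) n) (⋆-scaleʳ y δ (pow y) n) ⟩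
    y ^ n + y * (δ ⋆ pow y) n                 ≈⟨ step n ⟩
    fromℕ (suc n) * y ^ n                     ∎
    where
    step : ∀ n → y ^ n + y * (δ ⋆ pow y) n ≈ fromℕ (suc n) * y ^ n
    step zero = begin
      1# + y * (0# * 1#) ≈⟨ +-congˡ (trans (*-congˡ (zeroˡ _)) (zeroʳ _)) ⟩
      1# + 0#            ≈⟨ +-identityʳ _ ⟩
      1#                 ≈⟨ trans (*-identityʳ _) fromℕ-1 ⟨
      fromℕ 1 * 1#       ∎
    step (suc n) = begin
      y * y ^ n + y * (δ ⋆ pow y) (suc n)          ≈⟨ +-congˡ (*-congˡ (δ-⋆-pow y n)) ⟩
      y * y ^ n + y * (fromℕ (suc n) * y ^ n)      ≈⟨ solve 3 (λ y p f → y :* p :+ y :* (f :* p) := (con ℚ.1ℚ :+ f) :* (y :* p)) refl y (y ^ n) (fromℕ (suc n)) ⟩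
      (ι ℚ.1ℚ + fromℕ (suc n)) * (y * y ^ n)       ≈⟨ *-congʳ (trans (fromℕ-suc (suc n)) (+-congʳ (sym ι-1))) ⟨
      fromℕ (suc (suc n)) * (y * y ^ n)            ∎

  -- Bernoulli numbers and polynomials.

  β : ℕ → Carrier
  β n = ι (bernoulli n)

  β-0 : β 0 ≈ 1#
  β-0 = ι-1

  -- `nextBernoulli` is this equation solved for its last unknown; since C(n+2, n+1) = n + 2,
  -- multiplying back clears its division and leaves the negative of the earlier terms.
  β-recurrence : ∀ n → ∑[ i ≤ suc n ] (fromℕ (suc (suc n) C toℕ i) * β (toℕ i)) ≈ 0#
  β-recurrence n = begin
    ∑[ i ≤ suc n ] f (toℕ i)                         ≈⟨ ∑-last (suc n) f ⟩
    ∑[ i ≤ n ] f (toℕ i) + fromℕ (N C suc n) * β (suc n)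
      ≈⟨ +-cong (∑-cong (suc n) λ i → trans (*-congˡ {fromℕ (N C toℕ i)} (ι-cong (≡.sym (lookup-firstBernoullis (suc n) i)))) (sym (ι-* (+ (N C toℕ i) ℚ./ 1) (lookup (firstBernoullis (suc n)) i))))
                (*-cong (fromℕ-cong choose) (trans (ι-* _ _) (*-congˡ (ι-neg _)))) ⟩
    ∑[ i ≤ n ] ι (q i) + fromℕ N * (ι (+ 1 ℚ./ N) * - ι (ℚAlgebra.sum-syntax ℚ-algebra (suc n) q))
      ≈⟨ +-cong (sym (ι-∑ (suc n) q)) (*-/-cancel N _) ⟩
    ι (ℚAlgebra.sum-syntax ℚ-algebra (suc n) q) + - ι (ℚAlgebra.sum-syntax ℚ-algebra (suc n) q) ≈⟨ -‿inverseʳ _ ⟩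
    0#                                               ∎
    where
    N = suc (suc n)
    f : ℕ → Carrier
    f i = fromℕ (N C i) * β i
    q : Fin (suc n) → ℚ
    q i = + (N C toℕ i) ℚ./ 1 ℚ.* lookup (firstBernoullis (suc n)) i
    choose : N C suc n ≡ N
    choose = ≡.trans (nCk≡nC[n∸k] (ℕ.n≤1+n (suc n))) (≡.trans (≡.cong (N C_) (ℕ.m+n∸n≡m 1 n)) (nC1≡n N))

  -- (t / (eᵗ - 1)) eᵗ = t / (eᵗ - 1) + t
  β-⋆-1 : ∀ n → (β ⋆ pow 1#) n ≈ β n + δ n
  β-⋆-1 zero          = trans (*-identityʳ _) (sym (+-identityʳ _))
  β-⋆-1 (suc zero)    = +-cong (*-identityʳ _) (trans (*-congʳ β-0) (trans (*-congˡ (*-identityˡ _)) (*-identityˡ _)))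
  β-⋆-1 (suc (suc n)) = begin
    (β ⋆ pow 1#) N                                             ≈⟨ ⋆-expand N β (pow 1#) ⟩
    ∑[ i ≤ N ] (fromℕ (N C toℕ i) * β (toℕ i) * 1# ^ (N ∸ toℕ i))
      ≈⟨ ∑-cong (suc N) (λ i → trans (*-congˡ {fromℕ (N C toℕ i) * β (toℕ i)} (1^n≈1 (N ∸ toℕ i))) (*-identityʳ _)) ⟩
    ∑[ i ≤ N ] (fromℕ (N C toℕ i) * β (toℕ i))                 ≈⟨ ∑-last N (λ i → fromℕ (N C i) * β i) ⟩
    ∑[ i < N ] (fromℕ (N C toℕ i) * β (toℕ i)) + fromℕ (N C N) * β N
      ≈⟨ +-cong (β-recurrence n) (trans (*-congʳ (trans (fromℕ-cong (nCn≡1 N)) fromℕ-1)) (*-identityˡ _)) ⟩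
    0# + β N                                                   ≈⟨ +-comm _ _ ⟩
    β N + 0#                                                   ∎
    where N = suc (suc n)

  bernoulliPoly≈⋆ : ∀ n x → bernoulliPoly A n x ≈ (β ⋆ pow x) n
  bernoulliPoly≈⋆ n x = sym (⋆-expand n β (pow x))

  bernoulliPoly-cong : ∀ n {x y} → x ≈ y → bernoulliPoly A n x ≈ bernoulliPoly A n y
  bernoulliPoly-cong n x≈y = ∑-cong (suc n) λ i → *-congˡ {fromℕ (n C toℕ i) * β (toℕ i)} (^-congˡ (n ∸ toℕ i) x≈y)

  bernoulliPoly-0 : ∀ n → bernoulliPoly A n 0# ≈ β n
  bernoulliPoly-0 n = begin
    bernoulliPoly A n 0# ≈⟨ bernoulliPoly≈⋆ n 0# ⟩
    (β ⋆ pow 0#) n       ≈⟨ ⋆-cong {β} {β} (λ _ → refl) 0^k n ⟩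
    (β ⋆ ε) n            ≈⟨ ⋆-comm β ε n ⟩
    (ε ⋆ β) n            ≈⟨ ε-⋆ β n ⟩
    β n                  ∎
    where
    0^k : ∀ k → 0# ^ k ≈ ε k
    0^k zero    = refl
    0^k (suc k) = zeroˡ _

  -- Multiplying `β-⋆-1` by e^(yt) gives t e^((1+y)t)/(e^t - 1) = t e^(yt)/(e^t - 1) + t e^(yt),
  -- which is compared in degree n + 1.
  bernoulliPoly-difference : ∀ n y →
    bernoulliPoly A (suc n) (1# + y) ≈ bernoulliPoly A (suc n) y + fromℕ (suc n) * y ^ n
  bernoulliPoly-difference n y = begin
    bernoulliPoly A N (1# + y)           ≈⟨ bernoulliPoly≈⋆ N (1# + y) ⟩
    (β ⋆ pow (1# + y)) N                 ≈⟨ ⋆-cong {β} {β} (λ _ → refl) (pow-⋆ 1# y) N ⟨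
    (β ⋆ (pow 1# ⋆ pow y)) N             ≈⟨ ⋆-assoc β (pow 1#) (pow y) N ⟨
    ((β ⋆ pow 1#) ⋆ pow y) N             ≈⟨ ⋆-cong {g = pow y} {pow y} β-⋆-1 (λ _ → refl) N ⟩
    ((λ k → β k + δ k) ⋆ pow y) N        ≈⟨ ⋆-distribʳ-+ β δ (pow y) N ⟩
    (β ⋆ pow y) N + (δ ⋆ pow y) N        ≈⟨ +-cong (sym (bernoulliPoly≈⋆ N y)) (δ-⋆-pow y n) ⟩
    bernoulliPoly A N y + fromℕ N * y ^ n ∎
    where N = suc n

  -- The sum unfolds at its first term, so the induction moves the base point from y to 1 + y and
  -- the difference equation absorbs the term removed. The additive form keeps division and
  -- subtraction out of the induction.
  bernoulliPoly-telescope : ∀ n m y →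
    fromℕ (suc n) * ∑[ k < m ] ((y + fromℕ (toℕ k)) ^ n) + bernoulliPoly A (suc n) y
      ≈ bernoulliPoly A (suc n) (y + fromℕ m)
  bernoulliPoly-telescope n zero y = begin
    fromℕ (suc n) * 0# + bernoulliPoly A (suc n) y ≈⟨ +-congʳ (zeroʳ _) ⟩
    0# + bernoulliPoly A (suc n) y                 ≈⟨ +-identityˡ _ ⟩
    bernoulliPoly A (suc n) y                      ≈⟨ bernoulliPoly-cong (suc n) (trans (+-congˡ fromℕ-0) (+-identityʳ y)) ⟨
    bernoulliPoly A (suc n) (y + fromℕ 0)          ∎
  bernoulliPoly-telescope n (suc m) y = begin
    N * ((y + fromℕ 0) ^ n + ∑[ k < m ] ((y + fromℕ (suc (toℕ k))) ^ n)) + bernoulliPoly A (suc n) y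
      ≈⟨ +-congʳ (*-congˡ (+-cong (^-congˡ n (trans (+-congˡ fromℕ-0) (+-identityʳ y))) (∑-cong m λ k → ^-congˡ n (shift (toℕ k))))) ⟩
    N * (y ^ n + ∑[ k < m ] (((1# + y) + fromℕ (toℕ k)) ^ n)) + bernoulliPoly A (suc n) y
      ≈⟨ solve 4 (λ N p s b → N :* (p :+ s) :+ b := N :* s :+ (b :+ N :* p)) refl N (y ^ n) _ _ ⟩
    N * ∑[ k < m ] (((1# + y) + fromℕ (toℕ k)) ^ n) + (bernoulliPoly A (suc n) y + N * y ^ n)
      ≈⟨ +-congˡ (bernoulliPoly-difference n y) ⟨
    N * ∑[ k < m ] (((1# + y) + fromℕ (toℕ k)) ^ n) + bernoulliPoly A (suc n) (1# + y)
      ≈⟨ bernoulliPoly-telescope n m (1# + y) ⟩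
    bernoulliPoly A (suc n) (1# + y + fromℕ m)
      ≈⟨ bernoulliPoly-cong (suc n) (shift m) ⟨
    bernoulliPoly A (suc n) (y + fromℕ (suc m)) ∎
    where
    N = fromℕ (suc n)
    shift : ∀ k → y + fromℕ (suc k) ≈ 1# + y + fromℕ k
    shift k = trans (+-congˡ (fromℕ-suc k)) (trans (sym (+-assoc _ _ _)) (+-congʳ (+-comm _ _)))

  ∑-powers : ∀ n m y → ∑[ k < m ] ((y + fromℕ (toℕ k)) ^ n)
    ≈ (bernoulliPoly A (suc n) (y + fromℕ m) - bernoulliPoly A (suc n) y) / suc n
  ∑-powers n m y = /-unique (suc n) (begin
    fromℕ (suc n) * S         ≈⟨ solve 2 (λ s b → s := (s :+ b) :- b) refl _ _ ⟩
    (fromℕ (suc n) * S + B) - B ≈⟨ +-congʳ (bernoulliPoly-telescope n m y) ⟩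
    bernoulliPoly A (suc n) (y + fromℕ m) - B ∎)
    where
    S = ∑[ k < m ] ((y + fromℕ (toℕ k)) ^ n)
    B = bernoulliPoly A (suc n) y

  -- Sums over lists, carrying the permutation over to the box and the gaps.

  ∑ᴸ : (ℕ → Carrier) → List ℕ → Carrier
  ∑ᴸ F = foldr (λ k s → F k + s) 0#

  ∑ᴸ-++ : ∀ F xs ys → ∑ᴸ F (xs ++ ys) ≈ ∑ᴸ F xs + ∑ᴸ F ys
  ∑ᴸ-++ F []       ys = sym (+-identityˡ _)
  ∑ᴸ-++ F (x ∷ xs) ys = trans (+-congˡ (∑ᴸ-++ F xs ys)) (sym (+-assoc _ _ _))

  ∑ᴸ-↭ : ∀ F {xs ys} → xs ↭ ys → ∑ᴸ F xs ≈ ∑ᴸ F ys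
  ∑ᴸ-↭ F ↭.refl          = refl
  ∑ᴸ-↭ F (↭.prep x p)    = +-congˡ (∑ᴸ-↭ F p)
  ∑ᴸ-↭ F (↭.swap x y p)  = trans (+-congˡ (+-congˡ (∑ᴸ-↭ F p)))
    (solve 3 (λ x y s → x :+ (y :+ s) := y :+ (x :+ s)) refl (F x) (F y) _)
  ∑ᴸ-↭ F (↭.trans p q)   = trans (∑ᴸ-↭ F p) (∑ᴸ-↭ F q)

  ∑ᴸ-map : ∀ F (g : ℕ → ℕ) xs → ∑ᴸ F (map g xs) ≈ ∑ᴸ (F ∘ g) xs
  ∑ᴸ-map F g []       = refl
  ∑ᴸ-map F g (x ∷ xs) = +-congˡ (∑ᴸ-map F g xs)

  ∑ᴸ-cong : ∀ {F G} → (∀ k → F k ≈ G k) → ∀ xs → ∑ᴸ F xs ≈ ∑ᴸ G xs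
  ∑ᴸ-cong p []       = refl
  ∑ᴸ-cong p (x ∷ xs) = +-cong (p x) (∑ᴸ-cong p xs)

  ∑ᴸ-applyUpTo : ∀ F g n → ∑ᴸ F (applyUpTo g n) ≈ ∑[ k < n ] F (g (toℕ k))
  ∑ᴸ-applyUpTo F g zero    = refl
  ∑ᴸ-applyUpTo F g (suc n) = +-congˡ (∑ᴸ-applyUpTo F (g ∘ suc) n)

  ∑ᴸ-map-tabulate : ∀ {I : Set} F (h : I → ℕ) n (g : Fin n → I) →
                    ∑ᴸ F (map h (tabulate g)) ≈ ∑[ i < n ] F (h (g i))
  ∑ᴸ-map-tabulate F h zero    g = refl
  ∑ᴸ-map-tabulate F h (suc n) g = +-congˡ (∑ᴸ-map-tabulate F h n (g ∘ Fin.suc))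

  ∑ᴸ-cartesianProductWith : ∀ {I J : Set} F (h : I → J → ℕ) m n (f : Fin m → I) (g : Fin n → J) →
    ∑ᴸ F (cartesianProductWith h (tabulate f) (tabulate g)) ≈ ∑[ i < m ] (∑[ j < n ] F (h (f i) (g j)))
  ∑ᴸ-cartesianProductWith F h zero    n f g = refl
  ∑ᴸ-cartesianProductWith F h (suc m) n f g = trans
    (∑ᴸ-++ F (map (h (f Fin.zero)) (tabulate g)) _)
    (+-cong (∑ᴸ-map-tabulate F (h (f Fin.zero)) n g) (∑ᴸ-cartesianProductWith F h m n (f ∘ Fin.suc) g))

  ∑-box+gaps : ∀ a b .{{_ : NonZero a}} .{{_ : NonZero b}} → Coprime a b → (F : ℕ → Carrier) →
    ∑[ i < b ] (∑[ j < a ] F (toℕ i ℕ.* a ℕ.+ toℕ j ℕ.* b)) + ∑ᴸ F (gaps a b)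
      ≈ ∑[ k < a ℕ.* b ] F (toℕ k) + ∑ᴸ (λ g → F (a ℕ.* b ℕ.+ g)) (gaps a b)
  ∑-box+gaps a b coprime F = begin
    ∑[ i < b ] (∑[ j < a ] F (toℕ i ℕ.* a ℕ.+ toℕ j ℕ.* b)) + ∑ᴸ F (gaps a b)
      ≈⟨ +-congʳ (∑ᴸ-cartesianProductWith F (boxValue a b) b a (λ i → i) (λ j → j)) ⟨
    ∑ᴸ F (boxValues a b) + ∑ᴸ F (gaps a b)
      ≈⟨ ∑ᴸ-++ F (boxValues a b) (gaps a b) ⟨
    ∑ᴸ F (boxValues a b ++ gaps a b)
      ≈⟨ ∑ᴸ-↭ F (boxValues++gaps↭ a b coprime) ⟩
    ∑ᴸ F (upTo (a ℕ.* b) ++ map (a ℕ.* b ℕ.+_) (gaps a b))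
      ≈⟨ ∑ᴸ-++ F (upTo (a ℕ.* b)) _ ⟩
    ∑ᴸ F (upTo (a ℕ.* b)) + ∑ᴸ F (map (a ℕ.* b ℕ.+_) (gaps a b))
      ≈⟨ +-cong (∑ᴸ-applyUpTo F (λ k → k) (a ℕ.* b)) (∑ᴸ-map F (a ℕ.* b ℕ.+_) (gaps a b)) ⟩
    ∑[ k < a ℕ.* b ] F (toℕ k) + ∑ᴸ (λ g → F (a ℕ.* b ℕ.+ g)) (gaps a b) ∎

  -- The row i = 0 and the column j = 0 share their corner, which the left side counts twice; hence
  -- the extra `H 0 0` on the right.
  ∑∑-border : ∀ m n .{{_ : NonZero m}} .{{_ : NonZero n}} (H : ℕ → ℕ → Carrier) →
    ∑[ i < pred m ] (∑[ j < pred n ] H (suc (toℕ i)) (suc (toℕ j)))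
      + ∑[ j < n ] H 0 (toℕ j) + ∑[ i < m ] H (toℕ i) 0
    ≈ ∑[ i < m ] (∑[ j < n ] H (toℕ i) (toℕ j)) + H 0 0
  ∑∑-border (suc m) (suc n) H = begin
    T + R + (H 0 0 + C)
      ≈⟨ solve 4 (λ T R h C → T :+ R :+ (h :+ C) := R :+ (C :+ T) :+ h) refl T R (H 0 0) C ⟩
    R + (C + T) + H 0 0
      ≈⟨ +-congʳ (+-congˡ (∑-distrib-+ {m} (λ i → H (suc (toℕ i)) 0) (λ i → ∑[ j < n ] H (suc (toℕ i)) (suc (toℕ j))))) ⟨
    R + ∑[ i < m ] (∑[ j < suc n ] H (suc (toℕ i)) (toℕ j)) + H 0 0 ∎
    where
    T = ∑[ i < m ] (∑[ j < n ] H (suc (toℕ i)) (suc (toℕ j)))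
    R = ∑[ j < suc n ] H 0 (toℕ j)
    C = ∑[ i < m ] H (suc (toℕ i)) 0

  -- Power sums of the gaps and of arithmetic progressions.

  ∑ᴸ-pow : ∀ i xs → fromℕ (sum (map (ℕ._^ i) xs)) ≈ ∑ᴸ (λ g → fromℕ g ^ i) xs
  ∑ᴸ-pow i []       = fromℕ-0
  ∑ᴸ-pow i (x ∷ xs) = trans (fromℕ-+ (x ℕ.^ i) _) (+-cong (fromℕ-^ x i) (∑ᴸ-pow i xs))

  -- The power sums have generating function the sum of e^(gt), and multiplication by e^(yt) shifts
  -- every g by y.
  ∑ᴸ-pow-⋆ : ∀ y n xs → ((λ i → ∑ᴸ (λ g → fromℕ g ^ i) xs) ⋆ pow y) n ≈ ∑ᴸ (λ g → (y + fromℕ g) ^ n) xs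
  ∑ᴸ-pow-⋆ y n []       = ⋆-zeroˡ (pow y) n
  ∑ᴸ-pow-⋆ y n (x ∷ xs) = trans (⋆-distribʳ-+ (pow (fromℕ x)) _ (pow y) n)
    (+-cong (trans (pow-⋆ (fromℕ x) y n) (^-congˡ n (+-comm _ _))) (∑ᴸ-pow-⋆ y n xs))

  ∑-gaps-shifted : ∀ a b .{{_ : NonZero a}} .{{_ : NonZero b}} y n →
    ∑[ i ≤ n ] (fromℕ (n C toℕ i) * y ^ (n ∸ toℕ i) * fromℕ (sylvesterSum a b (toℕ i)))
      ≈ ∑ᴸ (λ g → (y + fromℕ g) ^ n) (gaps a b)
  ∑-gaps-shifted a b y n = begin
    ∑[ i ≤ n ] (fromℕ (n C toℕ i) * y ^ (n ∸ toℕ i) * fromℕ (sylvesterSum a b (toℕ i)))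
      ≈⟨ ∑-cong (suc n) (λ i → solve 3 (λ c p s → c :* p :* s := c :* s :* p) refl (fromℕ (n C toℕ i)) (y ^ (n ∸ toℕ i)) (S (toℕ i))) ⟩
    ∑[ i ≤ n ] (fromℕ (n C toℕ i) * S (toℕ i) * y ^ (n ∸ toℕ i))
      ≈⟨ ⋆-expand n S (pow y) ⟨
    (S ⋆ pow y) n
      ≈⟨ ⋆-cong {g = pow y} {pow y} (λ i → ∑ᴸ-pow i (gaps a b)) (λ _ → refl) n ⟩
    ((λ i → ∑ᴸ (λ g → fromℕ g ^ i) (gaps a b)) ⋆ pow y) n
      ≈⟨ ∑ᴸ-pow-⋆ y n (gaps a b) ⟩
    ∑ᴸ (λ g → (y + fromℕ g) ^ n) (gaps a b) ∎
    where
    S : ℕ → Carrier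
    S i = fromℕ (sylvesterSum a b i)

  -- Used at y = x + ab, where the right side is the sum over the shifted gaps. The sum over the
  -- unshifted gaps is kept as a summand to match `∑-box+gaps`.
  ∑-gaps-difference : ∀ a b .{{_ : NonZero a}} .{{_ : NonZero b}} x y n →
    ∑[ i ≤ n ] (fromℕ (n C toℕ i) * (y ^ (n ∸ toℕ i) - x ^ (n ∸ toℕ i)) * fromℕ (sylvesterSum a b (toℕ i)))
      + ∑ᴸ (λ g → (x + fromℕ g) ^ n) (gaps a b)
    ≈ ∑ᴸ (λ g → (y + fromℕ g) ^ n) (gaps a b)
  ∑-gaps-difference a b x y n = begin
    ∑[ i ≤ n ] d i + ∑ᴸ (λ g → (x + fromℕ g) ^ n) (gaps a b) ≈⟨ +-congˡ (∑-gaps-shifted a b x n) ⟨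
    ∑[ i ≤ n ] d i + ∑[ i ≤ n ] t x i                        ≈⟨ ∑-distrib-+ {suc n} d (t x) ⟨
    ∑[ i ≤ n ] (d i + t x i)
      ≈⟨ ∑-cong (suc n) (λ i → solve 4 (λ c p q s → c :* (p :- q) :* s :+ c :* q :* s := c :* p :* s) refl
           (fromℕ (n C toℕ i)) (y ^ (n ∸ toℕ i)) (x ^ (n ∸ toℕ i)) (fromℕ (sylvesterSum a b (toℕ i)))) ⟩
    ∑[ i ≤ n ] t y i                                         ≈⟨ ∑-gaps-shifted a b y n ⟩
    ∑ᴸ (λ g → (y + fromℕ g) ^ n) (gaps a b)                  ∎
    where
    t : Carrier → Fin (suc n) → Carrier
    t z i = fromℕ (n C toℕ i) * z ^ (n ∸ toℕ i) * fromℕ (sylvesterSum a b (toℕ i))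
    d : Fin (suc n) → Carrier
    d i = fromℕ (n C toℕ i) * (y ^ (n ∸ toℕ i) - x ^ (n ∸ toℕ i)) * fromℕ (sylvesterSum a b (toℕ i))

  -- Writing x + kd = d(x/d + k) turns step d into step 1 at the base point x/d, at the price of the
  -- factor d^n.
  ∑-progression : ∀ d m .{{_ : NonZero d}} n x →
    ∑[ k < m ] ((x + fromℕ (toℕ k ℕ.* d)) ^ n)
      ≈ fromℕ d ^ n * ((bernoulliPoly A (suc n) (x / d + fromℕ m) - bernoulliPoly A (suc n) (x / d)) / suc n)
  ∑-progression d m n x = begin
    ∑[ k < m ] ((x + fromℕ (toℕ k ℕ.* d)) ^ n)
      ≈⟨ ∑-cong m (λ k → trans (^-congˡ n (scaled (toℕ k))) (^-distrib-* (fromℕ d) (x / d + fromℕ (toℕ k)) n)) ⟩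
    ∑[ k < m ] (fromℕ d ^ n * (x / d + fromℕ (toℕ k)) ^ n)
      ≈⟨ *-distribˡ-sum {m} (fromℕ d ^ n) (λ k → (x / d + fromℕ (toℕ k)) ^ n) ⟨
    fromℕ d ^ n * ∑[ k < m ] ((x / d + fromℕ (toℕ k)) ^ n)
      ≈⟨ *-congˡ (∑-powers n m (x / d)) ⟩
    fromℕ d ^ n * ((bernoulliPoly A (suc n) (x / d + fromℕ m) - bernoulliPoly A (suc n) (x / d)) / suc n) ∎
    where
    scaled : ∀ k → x + fromℕ (k ℕ.* d) ≈ fromℕ d * (x / d + fromℕ k)
    scaled k = sym (begin
      fromℕ d * (x / d + fromℕ k)         ≈⟨ distribˡ _ _ _ ⟩
      fromℕ d * (x / d) + fromℕ d * fromℕ k ≈⟨ +-cong (*-/-cancel d x) (trans (*-comm _ _) (sym (fromℕ-* k d))) ⟩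
      x + fromℕ (k ℕ.* d)                 ∎)

  -- Assembling the identity, and its case x = 0.

  module _ (a b : ℕ) .{{_ : NonZero a}} .{{_ : NonZero b}} (n : ℕ) where

    1/[_^_] : ∀ d n .{{_ : NonZero d}} → Carrier
    1/[ d ^ n ] = ι (ℚ._/_ (+ 1) (d ℕ.^ n) {{ℕ.m^n≢0 d n}})

    box-/ : ∀ x i j → (x / (a ℕ.* b) + fromℕ j / a + fromℕ i / b) ^ n ≈ (x + fromℕ (i ℕ.* a ℕ.+ j ℕ.* b)) ^ n /[ a ℕ.* b ^ n ]
    box-/ x i j = trans (^-congˡ n (/-unique (a ℕ.* b) (begin
      fromℕ (a ℕ.* b) * (x / (a ℕ.* b) + fromℕ j / a + fromℕ i / b)
        ≈⟨ trans (distribˡ _ _ _) (+-congʳ (distribˡ _ _ _)) ⟩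
      fromℕ (a ℕ.* b) * (x / (a ℕ.* b)) + fromℕ (a ℕ.* b) * (fromℕ j / a) + fromℕ (a ℕ.* b) * (fromℕ i / b)
        ≈⟨ +-cong (+-cong (*-/-cancel (a ℕ.* b) x) (*-congʳ (fromℕ-* a b))) (*-congʳ (fromℕ-* a b)) ⟩
      x + fromℕ a * fromℕ b * (fromℕ j / a) + fromℕ a * fromℕ b * (fromℕ i / b)
        ≈⟨ solve 5 (λ x a b j i → x :+ a :* b :* j :+ a :* b :* i := x :+ (a :* (b :* i) :+ b :* (a :* j))) refl
             x (fromℕ a) (fromℕ b) (fromℕ j / a) (fromℕ i / b) ⟩
      x + (fromℕ a * (fromℕ b * (fromℕ i / b)) + fromℕ b * (fromℕ a * (fromℕ j / a)))
        ≈⟨ +-congˡ (+-cong (*-congˡ (*-/-cancel b (fromℕ i))) (*-congˡ (*-/-cancel a (fromℕ j)))) ⟩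
      x + (fromℕ a * fromℕ i + fromℕ b * fromℕ j)
        ≈⟨ +-congˡ (trans (fromℕ-+ (i ℕ.* a) (j ℕ.* b)) (+-cong (trans (fromℕ-* i a) (*-comm _ _)) (trans (fromℕ-* j b) (*-comm _ _)))) ⟨
      x + fromℕ (i ℕ.* a ℕ.+ j ℕ.* b) ∎))) (/-^ (a ℕ.* b) _ n)

    -- The factor a^n comes from a progression of step a. It cancels against (ab)^n = a^n b^n, which
    -- is why the Bernoulli difference at x/a has denominator b^n.
    cancelˡ-/[*^] : ∀ y → (fromℕ a ^ n * y) /[ a ℕ.* b ^ n ] ≈ y /[ b ^ n ]
    cancelˡ-/[*^] y = sym (/-unique ((a ℕ.* b) ℕ.^ n) {{ℕ.m^n≢0 (a ℕ.* b) n}} (begin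
      fromℕ ((a ℕ.* b) ℕ.^ n) * (y /[ b ^ n ])
        ≈⟨ *-congʳ (trans (fromℕ-^ (a ℕ.* b) n) (trans (^-congˡ n (fromℕ-* a b)) (^-distrib-* (fromℕ a) (fromℕ b) n))) ⟩
      fromℕ a ^ n * fromℕ b ^ n * (y /[ b ^ n ])
        ≈⟨ trans (*-assoc _ _ _) (*-congˡ (*-congʳ (sym (fromℕ-^ b n)))) ⟩
      fromℕ a ^ n * (fromℕ (b ℕ.^ n) * (y /[ b ^ n ]))
        ≈⟨ *-congˡ (*-/-cancel (b ℕ.^ n) {{ℕ.m^n≢0 b n}} y) ⟩
      fromℕ a ^ n * y ∎))

    cancelʳ-/[*^] : ∀ y → (fromℕ b ^ n * y) /[ a ℕ.* b ^ n ] ≈ y /[ a ^ n ]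
    cancelʳ-/[*^] y = sym (/-unique ((a ℕ.* b) ℕ.^ n) {{ℕ.m^n≢0 (a ℕ.* b) n}} (begin
      fromℕ ((a ℕ.* b) ℕ.^ n) * (y /[ a ^ n ])
        ≈⟨ *-congʳ (trans (fromℕ-^ (a ℕ.* b) n) (trans (^-congˡ n (trans (fromℕ-* a b) (*-comm _ _))) (^-distrib-* (fromℕ b) (fromℕ a) n))) ⟩
      fromℕ b ^ n * fromℕ a ^ n * (y /[ a ^ n ])
        ≈⟨ trans (*-assoc _ _ _) (*-congˡ (*-congʳ (sym (fromℕ-^ a n)))) ⟩
      fromℕ b ^ n * (fromℕ (a ℕ.^ n) * (y /[ a ^ n ]))
        ≈⟨ *-congˡ (*-/-cancel (a ℕ.^ n) {{ℕ.m^n≢0 a n}} y) ⟩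
      fromℕ b ^ n * y ∎))

    swap-/ : ∀ (i : ℚ) y → ι i * (y / suc n) ≈ ι i * y / suc n
    swap-/ i y = solve 3 (λ i j y → i :* (j :* y) := j :* (i :* y)) refl _ _ _

    -- Over the common denominator (ab)^n the left side is the box without its two borders. The term
    -- x^n is the corner, which is removed with each border and so has to be restored once.
    polynomial-identity : Coprime a b → ∀ x →
      ∑[ i < pred b ] (∑[ j < pred a ]
        ((x / (a ℕ.* b) + fromℕ (suc (toℕ j)) / a + fromℕ (suc (toℕ i)) / b) ^ n))
      ≈ x ^ n /[ a ℕ.* b ^ n ]
        - (bernoulliPoly A (suc n) (x / a + fromℕ b) - bernoulliPoly A (suc n) (x / a)) /[ b ^ n ] / suc n
        - (bernoulliPoly A (suc n) (x / b + fromℕ a) - bernoulliPoly A (suc n) (x / b)) /[ a ^ n ] / suc n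
        + (bernoulliPoly A (suc n) (x + fromℕ (a ℕ.* b)) - bernoulliPoly A (suc n) x) /[ a ℕ.* b ^ n ] / suc n
        + (∑[ i ≤ n ] (fromℕ (n C toℕ i)
             * ((x + fromℕ (a ℕ.* b)) ^ (n ∸ toℕ i) - x ^ (n ∸ toℕ i))
             * fromℕ (sylvesterSum a b (toℕ i)))) /[ a ℕ.* b ^ n ]
    polynomial-identity coprime x = begin
      ∑[ i < pred b ] (∑[ j < pred a ]
        ((x / ab + fromℕ (suc (toℕ j)) / a + fromℕ (suc (toℕ i)) / b) ^ n))
        ≈⟨ ∑-cong (pred b) (λ i → trans
             (∑-cong (pred a) (λ j → box-/ x (suc (toℕ i)) (suc (toℕ j))))
             (sym (*-distribˡ-sum {pred a} w (λ j → H (suc (toℕ i)) (suc (toℕ j)))))) ⟩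
      ∑[ i < pred b ] (w * ∑[ j < pred a ] H (suc (toℕ i)) (suc (toℕ j)))
        ≈⟨ *-distribˡ-sum {pred b} w (λ i → ∑[ j < pred a ] H (suc (toℕ i)) (suc (toℕ j))) ⟨
      w * T
        ≈⟨ *-congˡ T-expansion ⟩
      w * (x ^ n - C′ - R + full + D)
        ≈⟨ solve 6 (λ w p c r f d → w :* (p :- c :- r :+ f :+ d) := w :* p :- w :* c :- w :* r :+ w :* f :+ w :* d) refl
             w (x ^ n) C′ R full D ⟩
      w * x ^ n - w * C′ - w * R + w * full + w * D
        ≈⟨ +-congʳ (+-cong (+-cong (+-congˡ (-‿cong C′-value)) (-‿cong R-value)) full-value) ⟩
      w * x ^ n - Δ (x / a) b /[ b ^ n ] / suc n - Δ (x / b) a /[ a ^ n ] / suc n + Δ x ab /[ ab ^ n ] / suc n + w * D ∎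
      where
      ab = a ℕ.* b
      w = 1/[ ab ^ n ]
      Δ : Carrier → ℕ → Carrier
      Δ y m = bernoulliPoly A (suc n) (y + fromℕ m) - bernoulliPoly A (suc n) y
      F : ℕ → Carrier
      F k = (x + fromℕ k) ^ n
      H : ℕ → ℕ → Carrier
      H i j = F (i ℕ.* a ℕ.+ j ℕ.* b)
      T R C′ box full G D : Carrier
      T = ∑[ i < pred b ] (∑[ j < pred a ] H (suc (toℕ i)) (suc (toℕ j)))
      R = ∑[ j < a ] F (toℕ j ℕ.* b)
      C′ = ∑[ i < b ] F (toℕ i ℕ.* a)
      box = ∑[ i < b ] (∑[ j < a ] H (toℕ i) (toℕ j))
      full = ∑[ k < ab ] F (toℕ k)
      G = ∑ᴸ F (gaps a b)
      D = ∑[ i ≤ n ] (fromℕ (n C toℕ i)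
             * ((x + fromℕ ab) ^ (n ∸ toℕ i) - x ^ (n ∸ toℕ i)) * fromℕ (sylvesterSum a b (toℕ i)))

      border : T + R + C′ ≈ box + x ^ n
      border = begin
        T + R + C′
          ≈⟨ +-congˡ (∑-cong b (λ i → ^-congˡ n (+-congˡ (fromℕ-cong (≡.sym (ℕ.+-identityʳ (toℕ i ℕ.* a))))))) ⟩
        T + R + ∑[ i < b ] H (toℕ i) 0 ≈⟨ ∑∑-border b a H ⟩
        box + F 0                      ≈⟨ +-congˡ (^-congˡ n (trans (+-congˡ fromℕ-0) (+-identityʳ x))) ⟩
        box + x ^ n                    ∎

      box+G : box + G ≈ full + (D + G)
      box+G = begin
        box + G ≈⟨ ∑-box+gaps a b coprime F ⟩
        full + ∑ᴸ (λ g → F (ab ℕ.+ g)) (gaps a b)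
          ≈⟨ +-congˡ (∑ᴸ-cong (λ g → ^-congˡ n (trans (+-congˡ (fromℕ-+ ab g)) (sym (+-assoc _ _ _)))) (gaps a b)) ⟩
        full + ∑ᴸ (λ g → (x + fromℕ ab + fromℕ g) ^ n) (gaps a b)
          ≈⟨ +-congˡ (∑-gaps-difference a b x (x + fromℕ ab) n) ⟨
        full + (D + G) ∎

      T-expansion : T ≈ x ^ n - C′ - R + full + D
      T-expansion = begin
        T                                ≈⟨ solve 3 (λ t r c → t := (t :+ r :+ c) :- c :- r) refl T R C′ ⟩
        (T + R + C′) - C′ - R            ≈⟨ +-congʳ (+-congʳ border) ⟩
        (box + x ^ n) - C′ - R
          -- `G` is added and subtracted, because `box` is known only together with it.
          ≈⟨ solve 5 (λ y p c r g → (y :+ p) :- c :- r := (y :+ g) :+ (p :- g :- c :- r)) refl box (x ^ n) C′ R G ⟩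
        (box + G) + (x ^ n - G - C′ - R) ≈⟨ +-congʳ box+G ⟩
        full + (D + G) + (x ^ n - G - C′ - R)
          ≈⟨ solve 6 (λ f d g p c r → f :+ (d :+ g) :+ (p :- g :- c :- r) := p :- c :- r :+ f :+ d) refl full D G (x ^ n) C′ R ⟩
        x ^ n - C′ - R + full + D        ∎

      C′-value : w * C′ ≈ Δ (x / a) b /[ b ^ n ] / suc n
      C′-value = trans (*-congˡ (∑-progression a b n x)) (trans (cancelˡ-/[*^] _) (swap-/ _ _))

      R-value : w * R ≈ Δ (x / b) a /[ a ^ n ] / suc n
      R-value = trans (*-congˡ (∑-progression b a n x)) (trans (cancelʳ-/[*^] _) (swap-/ _ _))

      full-value : w * full ≈ Δ x ab /[ ab ^ n ] / suc n
      full-value = trans (*-congˡ (∑-powers n ab x)) (swap-/ _ _)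

    -- The term i = n of the general identity carries (ab)^0 - 0^0 = 0, so the sum stops below n.
    -- The summand 0^n is what remains of x^n: it is 1 for n = 0 and 0 otherwise.
    identity-at-0 : Coprime a b →
      ∑[ i < pred b ] (∑[ j < pred a ]
        ((fromℕ (suc (toℕ j)) / a + fromℕ (suc (toℕ i)) / b) ^ n))
      ≈ 0# ^ n /[ a ℕ.* b ^ n ]
        + ∑[ i < n ] (fromℕ (n C toℕ i) * (fromℕ (sylvesterSum a b (toℕ i)) /[ a ℕ.* b ^ toℕ i ]))
        + (bernoulliPoly A (suc n) (fromℕ (a ℕ.* b)) /[ a ℕ.* b ^ n ]
            - bernoulliPoly A (suc n) (fromℕ a) /[ a ^ n ]
            - bernoulliPoly A (suc n) (fromℕ b) /[ b ^ n ]
            - β (suc n) * (1# /[ a ℕ.* b ^ n ] - 1# /[ a ^ n ] - 1# /[ b ^ n ])) / suc n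
    identity-at-0 coprime = begin
      ∑[ i < pred b ] (∑[ j < pred a ] ((fromℕ (suc (toℕ j)) / a + fromℕ (suc (toℕ i)) / b) ^ n))
        ≈⟨ ∑-cong (pred b) (λ i → ∑-cong (pred a) (λ j → ^-congˡ n (+-congʳ
             (trans (+-congʳ (zeroʳ _)) (+-identityˡ _))))) ⟨
      ∑[ i < pred b ] (∑[ j < pred a ] ((0# / ab + fromℕ (suc (toℕ j)) / a + fromℕ (suc (toℕ i)) / b) ^ n))
        ≈⟨ polynomial-identity coprime 0# ⟩
      0# ^ n /[ ab ^ n ] - Δ (0# / a) b /[ b ^ n ] / suc n - Δ (0# / b) a /[ a ^ n ] / suc n + Δ 0# ab /[ ab ^ n ] / suc n
        + D /[ ab ^ n ]
        ≈⟨ +-cong (+-cong (+-cong (+-congˡ (-‿cong (*-congˡ (*-congˡ (Δ-0 b (zeroʳ _)))))) (-‿cong (*-congˡ (*-congˡ (Δ-0 a (zeroʳ _))))))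
             (*-congˡ (*-congˡ (Δ-0 ab refl)))) D-value ⟩
      0# ^ n /[ ab ^ n ] - (B b - β (suc n)) /[ b ^ n ] / suc n - (B a - β (suc n)) /[ a ^ n ] / suc n
        + (B ab - β (suc n)) /[ ab ^ n ] / suc n + E
        ≈⟨ solve 6 (λ z e s w p q → z :- s :* q :- s :* p :+ s :* w :+ e := z :+ e :+ s :* (w :- p :- q)) refl
             (0# ^ n /[ ab ^ n ]) E (ι (+ 1 ℚ./ suc n))
             ((B ab - β (suc n)) /[ ab ^ n ]) ((B a - β (suc n)) /[ a ^ n ]) ((B b - β (suc n)) /[ b ^ n ]) ⟩
      0# ^ n /[ ab ^ n ] + E
        + ((B ab - β (suc n)) /[ ab ^ n ] - (B a - β (suc n)) /[ a ^ n ] - (B b - β (suc n)) /[ b ^ n ]) / suc n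
        ≈⟨ +-congˡ (*-congˡ (collect (1/[ ab ^ n ]) (1/[ a ^ n ]) (1/[ b ^ n ]) (B ab) (B a) (B b))) ⟩
      0# ^ n /[ ab ^ n ] + E
        + (B ab /[ ab ^ n ] - B a /[ a ^ n ] - B b /[ b ^ n ]
            - β (suc n) * (1# /[ ab ^ n ] - 1# /[ a ^ n ] - 1# /[ b ^ n ])) / suc n ∎
      where
      ab = a ℕ.* b
      B : ℕ → Carrier
      B m = bernoulliPoly A (suc n) (fromℕ m)
      Δ : Carrier → ℕ → Carrier
      Δ y m = bernoulliPoly A (suc n) (y + fromℕ m) - bernoulliPoly A (suc n) y
      S : ℕ → Carrier
      S i = fromℕ (sylvesterSum a b i)
      d : ℕ → Carrier
      d i = fromℕ (n C i) * ((0# + fromℕ ab) ^ (n ∸ i) - 0# ^ (n ∸ i)) * S i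
      D E : Carrier
      D = ∑[ i ≤ n ] d (toℕ i)
      E = ∑[ i < n ] (fromℕ (n C toℕ i) * (S (toℕ i) /[ ab ^ toℕ i ]))

      -- Allowing any y equal to 0 covers the base points 0/a, 0/b and 0 together.
      Δ-0 : ∀ m {y} → y ≈ 0# → Δ y m ≈ B m - β (suc n)
      Δ-0 m y≈0 = +-cong
        (bernoulliPoly-cong (suc n) (trans (+-congʳ y≈0) (+-identityˡ _)))
        (-‿cong (trans (bernoulliPoly-cong (suc n) y≈0) (bernoulliPoly-0 (suc n))))

      d-top : d n ≈ 0#
      d-top = trans (*-congʳ (trans (*-congˡ {fromℕ (n C n)} (trans
        (+-cong (^-congʳ _ (ℕ.n∸n≡0 n)) (-‿cong (^-congʳ 0# (ℕ.n∸n≡0 n)))) (-‿inverseʳ 1#))) (zeroʳ _))) (zeroˡ (S n))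

      -- The exponent n - i is positive, so 0^(n - i) vanishes and the remaining (ab)^(n - i)
      -- reduces the denominator (ab)^n to (ab)^i.
      d-value : ∀ i → i ℕ.< n → d i /[ ab ^ n ] ≈ fromℕ (n C i) * (S i /[ ab ^ i ])
      d-value i i<n = sym (/-unique (ab ℕ.^ n) {{ℕ.m^n≢0 ab n}} (begin
        fromℕ (ab ℕ.^ n) * (fromℕ (n C i) * (S i /[ ab ^ i ]))
          ≈⟨ *-congʳ (trans (fromℕ-cong (≡.trans (≡.cong (ab ℕ.^_) (≡.sym (ℕ.m∸n+n≡m (ℕ.<⇒≤ i<n)))) (ℕ.^-distribˡ-+-* ab (n ∸ i) i)))
               (fromℕ-* (ab ℕ.^ (n ∸ i)) (ab ℕ.^ i))) ⟩
        fromℕ (ab ℕ.^ (n ∸ i)) * fromℕ (ab ℕ.^ i) * (fromℕ (n C i) * (S i /[ ab ^ i ]))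
          ≈⟨ solve 4 (λ p q c z → p :* q :* (c :* z) := c :* p :* (q :* z)) refl
               (fromℕ (ab ℕ.^ (n ∸ i))) (fromℕ (ab ℕ.^ i)) (fromℕ (n C i)) (S i /[ ab ^ i ]) ⟩
        fromℕ (n C i) * fromℕ (ab ℕ.^ (n ∸ i)) * (fromℕ (ab ℕ.^ i) * (S i /[ ab ^ i ]))
          ≈⟨ *-cong (*-congˡ power) (*-/-cancel (ab ℕ.^ i) {{ℕ.m^n≢0 ab i}} (S i)) ⟩
        fromℕ (n C i) * ((0# + fromℕ ab) ^ (n ∸ i) - 0# ^ (n ∸ i)) * S i ∎))
        where
        0^-vanishes : ∀ k → 0 ℕ.< k → 0# ^ k ≈ 0#
        0^-vanishes (suc k) _ = zeroˡ _
        power : fromℕ (ab ℕ.^ (n ∸ i)) ≈ (0# + fromℕ ab) ^ (n ∸ i) - 0# ^ (n ∸ i)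
        power = begin
          fromℕ (ab ℕ.^ (n ∸ i))                  ≈⟨ fromℕ-^ ab (n ∸ i) ⟩
          fromℕ ab ^ (n ∸ i)                      ≈⟨ ^-congˡ (n ∸ i) (+-identityˡ _) ⟨
          -- A zero is subtracted as a constant of the solver and then recognised as 0^(n - i).
          (0# + fromℕ ab) ^ (n ∸ i)               ≈⟨ solve 1 (λ x → x := x :- con ℚ.0ℚ) refl _ ⟩
          (0# + fromℕ ab) ^ (n ∸ i) - ι ℚ.0ℚ
            ≈⟨ +-congˡ (-‿cong (trans ι-0 (sym (0^-vanishes (n ∸ i) (ℕ.m<n⇒0<n∸m i<n))))) ⟩
          (0# + fromℕ ab) ^ (n ∸ i) - 0# ^ (n ∸ i) ∎

      collect : ∀ w p q X Y Z →
        w * (X - β (suc n)) - p * (Y - β (suc n)) - q * (Z - β (suc n))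
          ≈ w * X - p * Y - q * Z - β (suc n) * (w * 1# - p * 1# - q * 1#)
      collect w p q X Y Z = trans
        (solve 7 (λ β w p q X Y Z → w :* (X :- β) :- p :* (Y :- β) :- q :* (Z :- β)
                                    := w :* X :- p :* Y :- q :* Z :- β :* (w :- p :- q)) refl
           (β (suc n)) w p q X Y Z)
        (+-congˡ (-‿cong (*-congˡ (sym
          (+-cong (+-cong (*-identityʳ w) (-‿cong (*-identityʳ p))) (-‿cong (*-identityʳ q)))))))

      D-value : D /[ ab ^ n ] ≈ E
      D-value = begin
        D /[ ab ^ n ]                             ≈⟨ *-congˡ (trans (∑-last n d) (trans (+-congˡ d-top) (+-identityʳ _))) ⟩
        (∑[ i < n ] d (toℕ i)) /[ ab ^ n ]        ≈⟨ *-distribˡ-sum {n} 1/[ ab ^ n ] (λ i → d (toℕ i)) ⟩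
        ∑[ i < n ] (d (toℕ i) /[ ab ^ n ])        ≈⟨ ∑-cong n (λ i → d-value (toℕ i) (Fin.toℕ<n i)) ⟩
        E                                         ∎

mainTheorem5 : ∀ {c ℓ} (a b : ℕ) .{{_ : NonZero a}} .{{_ : NonZero b}} → Coprime a b → (n : ℕ) →
  ((A : ℚAlgebra c ℓ) → let open ℚAlgebra A in (x : Carrier) →
    ∑[ i < pred b ] (∑[ j < pred a ]
      ((x / (a ℕ.* b) + fromℕ (suc (toℕ j)) / a + fromℕ (suc (toℕ i)) / b) ^ n))
    ≈ x ^ n /[ a ℕ.* b ^ n ]
      - (bernoulliPoly A (suc n) (x / a + fromℕ b) - bernoulliPoly A (suc n) (x / a)) /[ b ^ n ] / suc n
      - (bernoulliPoly A (suc n) (x / b + fromℕ a) - bernoulliPoly A (suc n) (x / b)) /[ a ^ n ] / suc n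
      + (bernoulliPoly A (suc n) (x + fromℕ (a ℕ.* b)) - bernoulliPoly A (suc n) x) /[ a ℕ.* b ^ n ] / suc n
      + (∑[ i ≤ n ] (fromℕ (n C toℕ i)
           * ((x + fromℕ (a ℕ.* b)) ^ (n ∸ toℕ i) - x ^ (n ∸ toℕ i))
           * fromℕ (sylvesterSum a b (toℕ i)))) /[ a ℕ.* b ^ n ])
  ×
  (let open ℚAlgebra ℚ-algebra in
    ∑[ i < pred b ] (∑[ j < pred a ]
      ((fromℕ (suc (toℕ j)) / a + fromℕ (suc (toℕ i)) / b) ^ n))
    ≈ 0# ^ n /[ a ℕ.* b ^ n ]
      + ∑[ i < n ] (fromℕ (n C toℕ i) * (fromℕ (sylvesterSum a b (toℕ i)) /[ a ℕ.* b ^ toℕ i ]))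
      + (bernoulliPoly ℚ-algebra (suc n) (fromℕ (a ℕ.* b)) /[ a ℕ.* b ^ n ]
          - bernoulliPoly ℚ-algebra (suc n) (fromℕ a) /[ a ^ n ]
          - bernoulliPoly ℚ-algebra (suc n) (fromℕ b) /[ b ^ n ]
          - bernoulli (suc n) * (1# /[ a ℕ.* b ^ n ] - 1# /[ a ^ n ] - 1# /[ b ^ n ])) / suc n)
mainTheorem5 a b coprime n =
  (λ A → Algebraic.polynomial-identity A a b n coprime) , Algebraic.identity-at-0 ℚ-algebra a b n coprime
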